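{- As formal power series, with all sums over all plane partitions $\pi$, $$\sum_{\pi}q^{|\pi|_{uh}}=\prod_{k=1}^{\infty}\frac{1}{(1-q^k)^k}=\sum_{\pi}q^{|\pi|}.$$ Moreover, the pairs of statistics $(\mathrm{des}(\pi),|\pi|_{uh})$ and $(\mathrm{tr}(\pi),|\pi|)$ are also equidistributed: $$\sum_{\pi}t^{\mathrm{des}(\pi)}q^{|\pi|_{uh}}=\prod_{k=1}^{\infty}\frac{1}{(1-tq^k)^k}=\sum_{\pi}t^{\mathrm{tr}(\pi)}q^{|\pi|}.$$
   Context: A plane partition $\pi=(\pi_{ij})_{i,j\ge1}$ is a two-dimensional array of nonnegative integers with finitely many nonzero entries such that $\pi_{ij}\ge\pi_{i+1\,j}$ and $\pi_{ij}\ge\pi_{i\,j+1}$ for all $i,j$ ($i$ is the row index, $j$ the column index). Its volume is $|\pi|=\sum_{i,j}\pi_{ij}$ and its trace is $\mathrm{tr}(\pi)=\sum_i\pi_{ii}$. The descent set is $\mathrm{Des}(\pi)=\{(i,j):\pi_{ij}>\pi_{i+1\,j}\}$ and $\mathrm{des}(\pi)=|\mathrm{Des}(\pi)|$. The up-hook volume is $|\pi|_{uh}=\sum_{(i,j)\in\mathrm{Des}(\pi)}(\pi_{ij}+i-1)$. -}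

module Defs where

open import Algebra.Bundles.Raw using (RawRing)
import Algebra.Definitions.RawSemiring as RawSemiringDefs
open import Data.Fin.Base using (toℕ)
import Data.Integer.Base as ℤ
open import Data.List.Base using (List; map; foldr; filter; length; upTo; cartesianProduct)
import Data.List.Membership.Setoid as Membership
import Data.List.Relation.Unary.Unique.Setoid as Uniqueness
open import Data.Nat.Base using (ℕ; zero; suc; _+_; _∸_; _≤_)
open import Data.Nat.ListAction using (sum)
open import Data.Nat.Properties using (_<?_)
open import Data.Product.Base using (_×_; _,_; ∃-syntax)
open import Data.Sum.Base using (_⊎_)
open import Data.Vec.Base using (Vec; []; _∷_; head; lookup)
open import Level using (_⊔_; 0ℓ)
open import Relation.Binary.Bundles using (Setoid)
open import Relation.Binary.PropositionalEquality.Core using (_≡_; refl; sym; trans)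

powerSeries : ∀ {c ℓ} → RawRing c ℓ → RawRing c ℓ
powerSeries R = record
  { Carrier = ℕ → R.Carrier
  ; _≈_     = λ f g → ∀ n → f n R.≈ g n
  ; _+_     = λ f g n → f n R.+ g n
  ; _*_     = λ f g n → RS.sum {suc n} (λ i → f (toℕ i) R.* g (n ∸ toℕ i))
  ; -_      = λ f n → R.- f n
  ; 0#      = λ _ → R.0#
  ; 1#      = λ { zero → R.1# ; (suc _) → R.0# }
  }
  where
  module R = RawRing R
  module RS = RawSemiringDefs R.rawSemiring

module PowerSeries {c ℓ} (R : RawRing c ℓ) where

  private
    module R  = RawRing R
    module RS = RawSemiringDefs R.rawSemiring

  open RawRing (powerSeries R) public
    using (1#; -_) renaming (Carrier to Series; _≈_ to _≋_; _+_ to _⊕_; _*_ to _⊛_)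
  open RawSemiringDefs (RawRing.rawSemiring (powerSeries R)) public
    using (_^_; product)

  constant : R.Carrier → Series
  constant a zero    = a
  constant a (suc _) = R.0#

  indeterminate : Series
  indeterminate 1 = R.1#
  indeterminate _ = R.0#

  -- For f = 1 + f₁x + f₂x² + ⋯ , the coefficients gₙ, …, g₀ of 1/f, from
  -- g₀ = 1 and gₙ₊₁ = - (f₁gₙ + f₂gₙ₋₁ + ⋯ + fₙ₊₁g₀).

  reciprocalCoefficients : Series → (n : ℕ) → Vec R.Carrier (suc n)
  reciprocalCoefficients f zero    = R.1# ∷ []
  reciprocalCoefficients f (suc n) =
    R.- RS.sum (λ i → f (suc (toℕ i)) R.* lookup gs i) ∷ gs
    where gs = reciprocalCoefficients f n

  -- 1/f; only meaningful when f has constant coefficient 1.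

  reciprocal : Series → Series
  reciprocal f n = head (reciprocalCoefficients f n)

  -- F = ∏_{k≥1} f k, where f k is stored at index k ∸ 1: each coefficient
  -- of the partial products is eventually that of F.

  IsInfiniteProduct : (ℕ → Series) → Series → Set ℓ
  IsInfiniteProduct f F =
    ∀ n → ∃[ N ] (∀ M → N ≤ M → product {M} (λ i → f (toℕ i)) n R.≈ F n)

  -- F = ∑_{x ∈ S} f x: for each n only finitely many x contribute to the
  -- n-th coefficient, and the finite sum of their contributions is F n.
  -- The list may also contain elements whose contribution is zero.

  IsSum : ∀ {a r} (S : Setoid a r) → (Setoid.Carrier S → Series) → Series →
          Set (a ⊔ r ⊔ ℓ)
  IsSum S f F = ∀ n → ∃[ xs ]
      Unique xs
    × (∀ x → f x n R.≉ R.0# → x ∈ xs)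
    × foldr R._+_ R.0# (map (λ x → f x n) xs) R.≈ F n
    where
    open Membership S using (_∈_)
    open Uniqueness S using (Unique)

ℤ[[t]] : RawRing 0ℓ 0ℓ
ℤ[[t]] = powerSeries ℤ.+-*-rawRing

-- Series in ℤ[[q]].

module Uni where
  open PowerSeries ℤ.+-*-rawRing public

  q : Series
  q = indeterminate

  factor : ℕ → Series
  factor i = reciprocal ((1# ⊕ (- (q ^ k))) ^ k)
    where k = suc i

-- Series in t and q, taken in ℤ[[t]][[q]].

module Bi where
  open PowerSeries ℤ[[t]] public

  q t : Series
  q = indeterminate
  t = constant (PowerSeries.indeterminate ℤ.+-*-rawRing)

  factor : ℕ → Series
  factor i = reciprocal ((1# ⊕ (- (t ⊛ (q ^ k)))) ^ k)
    where k = suc i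

-- Rows and columns are numbered from 0.  Having finitely many nonzero
-- entries is vanishing outside some square {0,…,size-1}².

record PlanePartition : Set where
  field
    entry            : ℕ → ℕ → ℕ
    down-decreasing  : ∀ i j → entry (suc i) j ≤ entry i j
    right-decreasing : ∀ i j → entry i (suc j) ≤ entry i j
    size             : ℕ
    vanishing        : ∀ i j → size ≤ i ⊎ size ≤ j → entry i j ≡ 0

  square : List (ℕ × ℕ)
  square = cartesianProduct (upTo size) (upTo size)

open PlanePartition

-- Two plane partitions are equal when their entries are; size is not
-- required to be minimal and is not compared.

planePartitions : Setoid 0ℓ 0ℓ
planePartitions = record
  { Carrier       = PlanePartition
  ; _≈_           = λ π ρ → ∀ i j → entry π i j ≡ entry ρ i j
  ; isEquivalence = record
    { refl  = λ i j → refl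
    ; sym   = λ e i j → sym (e i j)
    ; trans = λ e e′ i j → trans (e i j) (e′ i j)
    }
  }

-- Entries outside the square are zero, so they contribute neither to the
-- volume and trace nor to the descent set.

volume : PlanePartition → ℕ
volume π = sum (map (λ (i , j) → entry π i j) (square π))

trace : PlanePartition → ℕ
trace π = sum (map (λ i → entry π i i) (upTo (size π)))

Des : PlanePartition → List (ℕ × ℕ)
Des π = filter (λ (i , j) → entry π (suc i) j <? entry π i j) (square π)

des : PlanePartition → ℕ
des π = length (Des π)

-- The summand is π_ij + i - 1 for rows numbered from 1.

upHookVolume : PlanePartition → ℕ
upHookVolume π = sum (map (λ (i , j) → entry π i j + i) (Des π))

-- Both generating functions count the matrices a of natural numbers with
-- finite support, indexed by i, j ≥ 0, by ∑ a i j and ∑ a i j (i + j + 1): the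
-- k entries with i + j + 1 = k account for the factor 1/(1 - tq^k)^k.
--
-- From a one grows partitions L i j, empty for large i or j, by the local rule
-- of the RSK correspondence, which determines L i j from a i j and the three
-- neighbours L (i+1) j, L i (j+1), L (i+1) (j+1); conversely it determines a i j
-- and L (i+1) (j+1) from the other three partitions.
--
-- The partitions L i 0 and L 0 j are the diagonals of a plane partition. By the
-- second reading of the rule this is a bijection, and since the local rule
-- gives |L i j| + |L (i+1) (j+1)| = |L (i+1) j| + |L i (j+1)| + a i j, the trace
-- is ∑ a i j and the volume is ∑ a i j (i + j + 1).
--
-- The first parts c i l of L i l form a plane partition too, and they satisfy
-- the last passage recursion c i l = max (c (i+1) l) (c i (l+1)) + a i l, which
-- determines a from c and c from a. If π is obtained from c by conjugating each
-- row, then row i of π has exactly a i l descents at entries equal to l + 1, so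
-- des π = ∑ a i l and π has up-hook volume ∑ a i l (i + l + 1).

module Submission where

open import Algebra.Bundles using (CommutativeRing)
open import Algebra.Bundles.Raw using (RawRing)
import Algebra.Properties.CommutativeMonoid.Sum as CommutativeMonoidSum
import Algebra.Properties.CommutativeSemigroup as CommutativeSemigroupProperties
import Algebra.Properties.CommutativeSemiring.Exp as Exp
import Algebra.Properties.Monoid.Sum as MonoidSum
import Algebra.Properties.Ring as RingProperties
import Algebra.Properties.Semiring.Sum as SemiringSum
open import Data.Fin.Base using (Fin; toℕ; fromℕ; inject₁; zero; suc)
open import Data.Fin.Properties using (toℕ-inject₁; toℕ-fromℕ)
import Data.Integer.Base as ℤ
import Data.Integer.Properties as ℤ
open import Data.List.Base
  using (List; []; _∷_; _++_; map; foldr; replicate; applyUpTo; upTo; filter; length; cartesianProduct)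
open import Data.List.Membership.Propositional using (_∈_; _∉_)
open import Data.List.Membership.Propositional.Properties
  using (∈-++⁺ˡ; ∈-++⁺ʳ; ∈-++⁻; ∈-applyUpTo⁺; ∈-applyUpTo⁻)
import Data.List.Membership.Setoid as SetoidMembership
import Data.List.Membership.Setoid.Properties as SetoidMembershipₚ
open import Data.List.Properties using (map-++; map-∘; map-cong; map-upTo; map-applyUpTo; ++-identityʳ)
open import Data.List.Relation.Unary.All as All using (All; []; _∷_)
import Data.List.Relation.Unary.All.Properties as Allₚ
open import Data.List.Relation.Unary.AllPairs using ([]; _∷_)
import Data.List.Relation.Unary.AllPairs.Properties as AllPairsₚ
open import Data.List.Relation.Unary.Any using (here; there)
import Data.List.Relation.Unary.Any.Properties as Anyₚ
open import Data.List.Relation.Unary.Unique.Propositional using (Unique)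
import Data.List.Relation.Unary.Unique.Propositional.Properties as Uniqueₚ
import Data.List.Relation.Unary.Unique.Setoid as SetoidUnique
import Data.List.Relation.Unary.Unique.Setoid.Properties as SetoidUniqueₚ
open import Data.Nat.Base as ℕ using (ℕ; zero; suc; _∸_; _≤_; z≤n; s≤s)
import Data.Nat.ListAction as ListAction
open import Data.Nat.ListAction.Properties using (sum-++)
import Data.Nat.Properties as ℕ
open import Data.Nat.Tactic.RingSolver using (solve-∀)
open import Data.Product.Base using (_×_; _,_; proj₁; proj₂; ∃-syntax; curry)
open import Data.Product.Properties using (≡-dec)
open import Data.Sum.Base as Sum using (_⊎_; inj₁; inj₂; [_,_]′)
open import Data.Vec.Base using (lookup)
open import Function.Base using (_∘_; flip)
open import Level using (0ℓ)
open import Relation.Binary.Bundles using (Setoid)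
open import Relation.Binary.Definitions using (tri<; tri≈; tri>)
open import Relation.Binary.PropositionalEquality as ≡
  using (_≡_; _≢_; _≗_; cong; cong₂; subst; subst₂; module ≡-Reasoning)
import Relation.Binary.Reasoning.Setoid as SetoidReasoning
open import Relation.Nullary using (¬_; Dec; yes; no; contradiction)
open import Relation.Unary using (Decidable; Pred)
open import Defs
open PlanePartition

private variable
  A B : Set

-- Power series

module SeriesRing {c ℓ} (R : CommutativeRing c ℓ) where
  open CommutativeRing R
  open CommutativeSemigroupProperties +-commutativeSemigroup using (interchange)
  open MonoidSum +-monoid using (sum-cong-≋)
  open PowerSeries rawRing
    using (Series; _≋_; _⊕_; _⊛_; reciprocalCoefficients; reciprocal)
    renaming (1# to 1ₛ)
  open SetoidReasoning setoid

  -- By unfolding, `(f ⊛ g) (suc n)` is `f 0 * g (suc n) + (shift f ⊛ g) n`, so the laws of the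
  -- product go by induction on the coefficient, with `f` replaced by `shift f`.
  shift : Series → Series
  shift f = f ∘ suc

  ⊛-cong : ∀ {f f′ g g′} → f ≋ f′ → g ≋ g′ → f ⊛ g ≋ f′ ⊛ g′
  ⊛-cong p r n = sum-cong-≋ {suc n} (λ i → *-cong (p (toℕ i)) (r (n ∸ toℕ i)))

  zero-⊛ : ∀ f g n → (∀ m → f m ≈ 0#) → (f ⊛ g) n ≈ 0#
  zero-⊛ f g zero f≈0 = trans (+-identityʳ _) (trans (*-congʳ (f≈0 0)) (zeroˡ _))
  zero-⊛ f g (suc n) f≈0 = begin
    f 0 * g (suc n) + (shift f ⊛ g) n  ≈⟨ +-cong (*-congʳ (f≈0 0)) (zero-⊛ (shift f) g n (f≈0 ∘ suc)) ⟩
    0# * g (suc n) + 0#                ≈⟨ +-identityʳ _ ⟩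
    0# * g (suc n)                     ≈⟨ zeroˡ _ ⟩
    0#                                 ∎

  constant-⊛ : ∀ f g n → (∀ m → f (suc m) ≈ 0#) → (f ⊛ g) n ≈ f 0 * g n
  constant-⊛ f g zero    _   = +-identityʳ _
  constant-⊛ f g (suc n) f≈0 = trans (+-congˡ (zero-⊛ (shift f) g n f≈0)) (+-identityʳ _)

  ⊛-distribʳ : ∀ h f g → (f ⊕ g) ⊛ h ≋ (f ⊛ h) ⊕ (g ⊛ h)
  ⊛-distribʳ h f g zero = begin
    (f 0 + g 0) * h 0 + 0#            ≈⟨ +-identityʳ _ ⟩
    (f 0 + g 0) * h 0                 ≈⟨ distribʳ _ _ _ ⟩
    f 0 * h 0 + g 0 * h 0             ≈⟨ +-cong (+-identityʳ _) (+-identityʳ _) ⟨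
    (f 0 * h 0 + 0#) + (g 0 * h 0 + 0#) ∎
  ⊛-distribʳ h f g (suc n) = begin
    (f 0 + g 0) * h (suc n) + ((shift f ⊕ shift g) ⊛ h) n
      ≈⟨ +-cong (distribʳ _ _ _) (⊛-distribʳ h (shift f) (shift g) n) ⟩
    (f 0 * h (suc n) + g 0 * h (suc n)) + ((shift f ⊛ h) n + (shift g ⊛ h) n)
      ≈⟨ interchange _ _ _ _ ⟩
    (f ⊛ h) (suc n) + (g ⊛ h) (suc n) ∎

  scale-⊛ : ∀ x f g n → ((λ m → x * f m) ⊛ g) n ≈ x * (f ⊛ g) n
  scale-⊛ x f g zero = begin
    x * f 0 * g 0 + 0#   ≈⟨ +-cong (*-assoc _ _ _) (sym (zeroʳ x)) ⟩
    x * (f 0 * g 0) + x * 0# ≈⟨ distribˡ _ _ _ ⟨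
    x * (f 0 * g 0 + 0#) ∎
  scale-⊛ x f g (suc n) = begin
    x * f 0 * g (suc n) + ((λ m → x * f (suc m)) ⊛ g) n
      ≈⟨ +-cong (*-assoc _ _ _) (scale-⊛ x (shift f) g n) ⟩
    x * (f 0 * g (suc n)) + x * (shift f ⊛ g) n
      ≈⟨ distribˡ _ _ _ ⟨
    x * (f ⊛ g) (suc n) ∎

  ⊛-assoc : ∀ f g h → (f ⊛ g) ⊛ h ≋ f ⊛ (g ⊛ h)
  ⊛-assoc f g h zero = begin
    (f 0 * g 0 + 0#) * h 0 + 0#  ≈⟨ +-congʳ (*-congʳ (+-identityʳ _)) ⟩
    f 0 * g 0 * h 0 + 0#         ≈⟨ +-congʳ (*-assoc _ _ _) ⟩
    f 0 * (g 0 * h 0) + 0#       ≈⟨ +-congʳ (*-congˡ (+-identityʳ _)) ⟨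
    f 0 * (g 0 * h 0 + 0#) + 0#  ∎
  ⊛-assoc f g h (suc n) = begin
    (f 0 * g 0 + 0#) * h (suc n) + (shift (f ⊛ g) ⊛ h) n
      ≈⟨ +-congʳ (trans (*-congʳ (+-identityʳ _)) (*-assoc _ _ _)) ⟩
    f 0 * (g 0 * h (suc n)) + (((λ m → f 0 * shift g m) ⊕ (shift f ⊛ g)) ⊛ h) n
      ≈⟨ +-congˡ (⊛-distribʳ h (λ m → f 0 * shift g m) (shift f ⊛ g) n) ⟩
    f 0 * (g 0 * h (suc n)) + (((λ m → f 0 * shift g m) ⊛ h) n + ((shift f ⊛ g) ⊛ h) n)
      ≈⟨ +-assoc _ _ _ ⟨
    (f 0 * (g 0 * h (suc n)) + ((λ m → f 0 * shift g m) ⊛ h) n) + ((shift f ⊛ g) ⊛ h) n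
      ≈⟨ +-cong (+-congˡ (scale-⊛ (f 0) (shift g) h n)) (⊛-assoc (shift f) g h n) ⟩
    (f 0 * (g 0 * h (suc n)) + f 0 * (shift g ⊛ h) n) + (shift f ⊛ (g ⊛ h)) n
      ≈⟨ +-congʳ (distribˡ _ _ _) ⟨
    f 0 * (g ⊛ h) (suc n) + (shift f ⊛ (g ⊛ h)) n ∎

  -- This splits off the last summand where unfolding splits off the first; the two decompositions
  -- together give commutativity.
  ⊛-suc : ∀ f g n → (f ⊛ g) (suc n) ≈ (f ⊛ shift g) n + f (suc n) * g 0
  ⊛-suc f g zero = begin
    f 0 * g 1 + (f 1 * g 0 + 0#)  ≈⟨ +-cong (sym (+-identityʳ _)) (+-identityʳ _) ⟩
    (f 0 * g 1 + 0#) + f 1 * g 0  ∎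
  ⊛-suc f g (suc n) = begin
    f 0 * g (suc (suc n)) + (shift f ⊛ g) (suc n)
      ≈⟨ +-congˡ (⊛-suc (shift f) g n) ⟩
    f 0 * g (suc (suc n)) + ((shift f ⊛ shift g) n + f (suc (suc n)) * g 0)
      ≈⟨ +-assoc _ _ _ ⟨
    (f ⊛ shift g) (suc n) + f (suc (suc n)) * g 0 ∎

  ⊛-comm : ∀ f g → f ⊛ g ≋ g ⊛ f
  ⊛-comm f g zero    = +-congʳ (*-comm _ _)
  ⊛-comm f g (suc n) = begin
    f 0 * g (suc n) + (shift f ⊛ g) n  ≈⟨ +-cong (*-comm _ _) (⊛-comm (shift f) g n) ⟩
    g (suc n) * f 0 + (g ⊛ shift f) n  ≈⟨ +-comm _ _ ⟩
    (g ⊛ shift f) n + g (suc n) * f 0  ≈⟨ ⊛-suc g f n ⟨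
    (g ⊛ f) (suc n)                    ∎

  ⊛-identityˡ : ∀ f → 1ₛ ⊛ f ≋ f
  ⊛-identityˡ f n = trans (constant-⊛ 1ₛ f n (λ _ → refl)) (*-identityˡ _)

  powerSeriesRing : CommutativeRing c ℓ
  powerSeriesRing = record
    { RawRing (powerSeries rawRing)
    ; isCommutativeRing = record
      { isRing = record
        { +-isAbelianGroup = record
          { isGroup = record
            { isMonoid = record
              { isSemigroup = record
                { isMagma = record
                  { isEquivalence = record
                    { refl  = λ _ → refl
                    ; sym   = λ p n → sym (p n)
                    ; trans = λ p r n → trans (p n) (r n)
                    }
                  ; ∙-cong = λ p r n → +-cong (p n) (r n)
                  }
                ; assoc = λ f g h n → +-assoc _ _ _
                }
              ; identity = (λ f n → +-identityˡ _) , (λ f n → +-identityʳ _)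
              }
            ; inverse = (λ f n → -‿inverseˡ _) , (λ f n → -‿inverseʳ _)
            ; ⁻¹-cong = λ p n → -‿cong (p n)
            }
          ; comm = λ f g n → +-comm _ _
          }
        ; *-cong = ⊛-cong
        ; *-assoc = ⊛-assoc
        ; *-identity = ⊛-identityˡ , λ f n → trans (⊛-comm f 1ₛ n) (⊛-identityˡ f n)
        ; distrib = (λ h f g n → trans (⊛-comm h (f ⊕ g) n)
                                 (trans (⊛-distribʳ h f g n)
                                 (+-cong (⊛-comm f h n) (⊛-comm g h n))))
                  , ⊛-distribʳ
        }
      ; *-comm = ⊛-comm
      }
    }

  -- The vector lists the newest coefficient first, so position `i` holds coefficient `n ∸ i`, just
  -- as a convolution needs it.
  lookup-reciprocalCoefficients : ∀ f n (i : Fin (suc n)) →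
    lookup (reciprocalCoefficients f n) i ≡ reciprocal f (n ∸ toℕ i)
  lookup-reciprocalCoefficients f zero    zero    = _≡_.refl
  lookup-reciprocalCoefficients f (suc n) zero    = _≡_.refl
  lookup-reciprocalCoefficients f (suc n) (suc i) = lookup-reciprocalCoefficients f n i

  -- When `f 0` is 1, the recursion defining the reciprocal says exactly that each positive
  -- coefficient of the product cancels.
  ⊛-reciprocal : ∀ f → f 0 ≈ 1# → f ⊛ reciprocal f ≋ 1ₛ
  ⊛-reciprocal f f₀≈1 zero = trans (+-identityʳ _) (trans (*-identityʳ _) f₀≈1)
  ⊛-reciprocal f f₀≈1 (suc n) = begin
    f 0 * reciprocal f (suc n) + (shift f ⊛ reciprocal f) n
      ≈⟨ +-congʳ (trans (*-congʳ f₀≈1) (*-identityˡ _)) ⟩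
    reciprocal f (suc n) + (shift f ⊛ reciprocal f) n
      ≈⟨ +-congʳ (-‿cong (sum-cong-≋ (λ i → *-congˡ {f (suc (toℕ i))} (reflexive (lookup-reciprocalCoefficients f n i))))) ⟩
    - (shift f ⊛ reciprocal f) n + (shift f ⊛ reciprocal f) n
      ≈⟨ -‿inverseˡ _ ⟩
    0# ∎

-- Generating functions

-- If e n lists the objects of weight n of some kind, then adjoin op v e n
-- lists the objects of weight n that arise from them by applying any number
-- of times the operation op, which raises the weight by v + 1.

mutual
  adjoin : (A → A) → ℕ → (ℕ → List A) → ℕ → List A
  adjoin op v e n = e n ++ raised op v e v n

  -- raised op v e u n is the image under op of adjoin op v e (n - (u + 1)).

  raised : (A → A) → ℕ → (ℕ → List A) → ℕ → ℕ → List A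
  raised op v e u       zero    = []
  raised op v e zero    (suc n) = map op (adjoin op v e n)
  raised op v e (suc u) (suc n) = raised op v e u n

unit : A → ℕ → List A
unit x zero    = x ∷ []
unit x (suc n) = []

module _ (f : A → B) {opᴬ : A → A} {opᴮ : B → B} (f-op : f ∘ opᴬ ≗ opᴮ ∘ f) (v : ℕ)
         {e : ℕ → List A} {e′ : ℕ → List B} (f-e : map f ∘ e ≗ e′) where
  mutual
    -- Used with the sum of the entries as `f`, to carry the enumeration of matrices to the
    -- enumeration of their sizes.
    map-adjoin : map f ∘ adjoin opᴬ v e ≗ adjoin opᴮ v e′
    map-adjoin n = ≡.trans (map-++ f (e n) _) (cong₂ _++_ (f-e n) (map-raised v n))

    map-raised : ∀ u → map f ∘ raised opᴬ v e u ≗ raised opᴮ v e′ u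
    map-raised u       zero    = ≡.refl
    map-raised (suc u) (suc n) = map-raised u n
    map-raised zero    (suc n) = begin
      map f (map opᴬ (adjoin opᴬ v e n)) ≡⟨ map-∘ (adjoin opᴬ v e n) ⟨
      map (f ∘ opᴬ) (adjoin opᴬ v e n)   ≡⟨ map-cong f-op (adjoin opᴬ v e n) ⟩
      map (opᴮ ∘ f) (adjoin opᴬ v e n)   ≡⟨ map-∘ (adjoin opᴬ v e n) ⟩
      map opᴮ (map f (adjoin opᴬ v e n)) ≡⟨ cong (map opᴮ) (map-adjoin n) ⟩
      map opᴮ (adjoin opᴮ v e′ n)        ∎
      where open ≡.≡-Reasoning

raised-small : ∀ (op : A → A) v e {u n} → n ≤ u → raised op v e u n ≡ []
raised-small op v e z≤n       = ≡.refl
raised-small op v e (s≤s n≤u) = raised-small op v e n≤u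

adjoin-small : ∀ (op : A → A) v e {n} → n ≤ v → adjoin op v e n ≡ e n
adjoin-small op v e {n} n≤v = ≡.trans (cong (e n ++_) (raised-small op v e n≤v)) (++-identityʳ (e n))

-- sizes [v₁,…,vᵣ] n lists the sizes a₁ + ⋯ + aᵣ of the tuples a with
-- a₁(v₁ + 1) + ⋯ + aᵣ(vᵣ + 1) = n.

sizes : List ℕ → ℕ → List ℕ
sizes = foldr (adjoin suc) (unit 0)

-- The levels i + j of the cells with i + j < M, largest first. Level v occurs v + 1 times, which is
-- the exponent in the factor at index v.
triangleWeights : ℕ → List ℕ
triangleWeights zero    = []
triangleWeights (suc M) = replicate (suc M) M ++ triangleWeights M

sizes-replicate-small : ∀ k {v} vs {n} → n ≤ v → sizes (replicate k v ++ vs) n ≡ sizes vs n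
sizes-replicate-small zero        vs n≤v = ≡.refl
sizes-replicate-small (suc k) {v} vs n≤v =
  ≡.trans (adjoin-small suc v (sizes (replicate k v ++ vs)) n≤v) (sizes-replicate-small k vs n≤v)

-- An operation of level v ≥ n adds v + 1 > n to the weight, so it cannot occur in an object of
-- weight n. This is why the infinite product converges coefficientwise.
sizes-triangle-stable : ∀ {n M} → n ℕ.≤′ M → sizes (triangleWeights M) n ≡ sizes (triangleWeights n) n
sizes-triangle-stable ℕ.≤′-refl           = ≡.refl
sizes-triangle-stable (ℕ.≤′-step {M} n≤M) =
  ≡.trans (sizes-replicate-small (suc M) (triangleWeights M) (ℕ.≤′⇒≤ n≤M)) (sizes-triangle-stable n≤M)

-- `τ` marks the size: it is 1 for the univariate identity and the variable t for the bivariate one.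
module GeneratingFunctions {c ℓ} (R : CommutativeRing c ℓ) (τ : CommutativeRing.Carrier R) where
  open CommutativeRing R
  open SeriesRing R
  open Exp commutativeSemiring using (_^_)
  module S = CommutativeRing powerSeriesRing
  open PowerSeries rawRing
    using (Series; _≋_; _⊕_; _⊛_; constant; reciprocal; IsInfiniteProduct; product)
    renaming (indeterminate to q; -_ to ⊖_; 1# to 1ₛ; _^_ to _^ₛ_)
  open SetoidReasoning setoid

  evaluate : List ℕ → Carrier
  evaluate ms = foldr _+_ 0# (map (τ ^_) ms)

  evaluate-++ : ∀ ms ns → evaluate (ms ++ ns) ≈ evaluate ms + evaluate ns
  evaluate-++ []       ns = sym (+-identityˡ _)
  evaluate-++ (m ∷ ms) ns = trans (+-congˡ (evaluate-++ ms ns)) (sym (+-assoc _ _ _))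

  evaluate-suc : ∀ ms → evaluate (map suc ms) ≈ τ * evaluate ms
  evaluate-suc []       = sym (zeroʳ τ)
  evaluate-suc (m ∷ ms) = trans (+-congˡ (evaluate-suc ms)) (sym (distribˡ _ _ _))

  q-⊛-zero : ∀ f → (q ⊛ f) 0 ≈ 0#
  q-⊛-zero f = trans (+-identityʳ _) (zeroˡ _)

  q-⊛-suc : ∀ f n → (q ⊛ f) (suc n) ≈ f n
  q-⊛-suc f n = begin
    0# * f (suc n) + (shift q ⊛ f) n ≈⟨ trans (+-congʳ (zeroˡ _)) (+-identityˡ _) ⟩
    (shift q ⊛ f) n                  ≈⟨ constant-⊛ (shift q) f n (λ _ → refl) ⟩
    1# * f n                         ≈⟨ *-identityˡ _ ⟩
    f n                              ∎

  q^-diagonal : ∀ v → (q ^ₛ v) v ≈ 1#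
  q^-diagonal zero    = refl
  q^-diagonal (suc v) = trans (q-⊛-suc (q ^ₛ v) v) (q^-diagonal v)

  q^-off-diagonal : ∀ v n → ¬ v ≡ n → (q ^ₛ v) n ≈ 0#
  q^-off-diagonal zero    zero    v≢n = contradiction ≡.refl v≢n
  q^-off-diagonal zero    (suc n) v≢n = refl
  q^-off-diagonal (suc v) zero    v≢n = q-⊛-zero (q ^ₛ v)
  q^-off-diagonal (suc v) (suc n) v≢n = trans (q-⊛-suc (q ^ₛ v) n) (q^-off-diagonal v n (v≢n ∘ cong suc))

  step : ℕ → Series
  step v = constant τ ⊛ (q ^ₛ suc v)

  sizeSeries : List ℕ → Series
  sizeSeries vs n = evaluate (sizes vs n)

  module _ (v : ℕ) (vs : List ℕ) where
    private G = sizeSeries (v ∷ vs)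

    -- `raised` lowers `u` and `n` together, and on the right each factor q does the same. When `u`
    -- runs out, the operation `suc` on sizes accounts for the factor `τ`.
    evaluate-raised : ∀ u n → evaluate (raised suc v (sizes vs) u n) ≈ τ * ((q ^ₛ suc u) ⊛ G) n
    evaluate-raised u zero = begin
      0#                           ≈⟨ zeroʳ τ ⟨
      τ * 0#                       ≈⟨ *-congˡ (q-⊛-zero ((q ^ₛ u) ⊛ G)) ⟨
      τ * (q ⊛ ((q ^ₛ u) ⊛ G)) 0   ≈⟨ *-congˡ (⊛-assoc q (q ^ₛ u) G 0) ⟨
      τ * ((q ^ₛ suc u) ⊛ G) 0     ∎
    evaluate-raised u (suc n) = begin
      evaluate (raised suc v (sizes vs) u (suc n)) ≈⟨ previous u ⟩
      τ * ((q ^ₛ u) ⊛ G) n               ≈⟨ *-congˡ (q-⊛-suc ((q ^ₛ u) ⊛ G) n) ⟨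
      τ * (q ⊛ ((q ^ₛ u) ⊛ G)) (suc n)   ≈⟨ *-congˡ (⊛-assoc q (q ^ₛ u) G (suc n)) ⟨
      τ * ((q ^ₛ suc u) ⊛ G) (suc n)     ∎
      where
      previous : ∀ u → evaluate (raised suc v (sizes vs) u (suc n)) ≈ τ * ((q ^ₛ u) ⊛ G) n
      previous zero    = trans (evaluate-suc (sizes (v ∷ vs) n)) (*-congˡ (sym (⊛-identityˡ G n)))
      previous (suc u) = evaluate-raised u n

    -- The geometric series in the form of an equation for itself: a tuple either has first entry 0
    -- or arises from another one by raising that entry.
    sizeSeries-∷ : G ≋ sizeSeries vs ⊕ (step v ⊛ G)
    sizeSeries-∷ n = begin
      evaluate (sizes vs n ++ raised suc v (sizes vs) v n)
        ≈⟨ evaluate-++ (sizes vs n) _ ⟩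
      sizeSeries vs n + evaluate (raised suc v (sizes vs) v n)
        ≈⟨ +-congˡ (evaluate-raised v n) ⟩
      sizeSeries vs n + τ * ((q ^ₛ suc v) ⊛ G) n
        ≈⟨ +-congˡ (constant-⊛ (constant τ) ((q ^ₛ suc v) ⊛ G) n (λ _ → refl)) ⟨
      sizeSeries vs n + (constant τ ⊛ ((q ^ₛ suc v) ⊛ G)) n
        ≈⟨ +-congˡ (⊛-assoc (constant τ) (q ^ₛ suc v) G n) ⟨
      sizeSeries vs n + (step v ⊛ G) n ∎

  denominator : ℕ → Series
  denominator v = 1ₛ ⊕ (⊖ step v)

  module SR = SetoidReasoning S.setoid

  -- Moving `step v ⊛ G` to the other side of `sizeSeries-∷` shows that one denominator cancels one
  -- weight, without any division.
  denominator-⊛ : ∀ v vs → denominator v ⊛ sizeSeries (v ∷ vs) ≋ sizeSeries vs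
  denominator-⊛ v vs = SR.begin
    (1ₛ ⊕ (⊖ step v)) ⊛ G          SR.≈⟨ S.distribʳ G 1ₛ (⊖ step v) ⟩
    (1ₛ ⊛ G) ⊕ ((⊖ step v) ⊛ G)    SR.≈⟨ S.+-cong {1ₛ ⊛ G} (S.*-identityˡ G) (λ n → sym (-‿distribˡ-* (step v) G n)) ⟩
    G ⊕ (⊖ (step v ⊛ G))           SR.≈⟨ S.+-congʳ {⊖ (step v ⊛ G)} (sizeSeries-∷ v vs) ⟩
    (sizeSeries vs ⊕ (step v ⊛ G)) ⊕ (⊖ (step v ⊛ G))
      SR.≈⟨ S.+-assoc (sizeSeries vs) (step v ⊛ G) _ ⟩
    sizeSeries vs ⊕ ((step v ⊛ G) ⊕ (⊖ (step v ⊛ G)))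
      SR.≈⟨ S.+-congˡ {sizeSeries vs} (S.-‿inverseʳ (step v ⊛ G)) ⟩
    sizeSeries vs ⊕ S.0#           SR.≈⟨ S.+-identityʳ (sizeSeries vs) ⟩
    sizeSeries vs                  SR.∎
    where
    G = sizeSeries (v ∷ vs)
    open RingProperties S.ring using (-‿distribˡ-*)

  denominator^-⊛ : ∀ k v vs → (denominator v ^ₛ k) ⊛ sizeSeries (replicate k v ++ vs) ≋ sizeSeries vs
  denominator^-⊛ zero    v vs = S.*-identityˡ (sizeSeries vs)
  denominator^-⊛ (suc k) v vs = SR.begin
    (D ⊛ (D ^ₛ k)) ⊛ sizeSeries (v ∷ vs′) SR.≈⟨ S.*-congʳ {sizeSeries (v ∷ vs′)} (S.*-comm D (D ^ₛ k)) ⟩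
    ((D ^ₛ k) ⊛ D) ⊛ sizeSeries (v ∷ vs′) SR.≈⟨ S.*-assoc (D ^ₛ k) D _ ⟩
    (D ^ₛ k) ⊛ (D ⊛ sizeSeries (v ∷ vs′)) SR.≈⟨ S.*-congˡ {D ^ₛ k} (denominator-⊛ v vs′) ⟩
    (D ^ₛ k) ⊛ sizeSeries vs′             SR.≈⟨ denominator^-⊛ k v vs ⟩
    sizeSeries vs                         SR.∎
    where
    D = denominator v
    vs′ = replicate k v ++ vs

  ^-constantTerm : ∀ k {f} → f 0 ≈ 1# → (f ^ₛ k) 0 ≈ 1#
  ^-constantTerm zero    f₀≈1 = refl
  ^-constantTerm (suc k) f₀≈1 =
    trans (+-identityʳ _) (trans (*-cong f₀≈1 (^-constantTerm k f₀≈1)) (*-identityˡ 1#))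

  denominator-constantTerm : ∀ v → denominator v 0 ≈ 1#
  denominator-constantTerm v = begin
    1# + - (τ * (q ⊛ (q ^ₛ v)) 0 + 0#)  ≈⟨ +-congˡ (-‿cong (trans (+-identityʳ _) (trans (*-congˡ (q-⊛-zero (q ^ₛ v))) (zeroʳ τ)))) ⟩
    1# + - 0#                           ≈⟨ trans (+-congˡ -0#≈0#) (+-identityʳ 1#) ⟩
    1#                                  ∎
    where open RingProperties ring using (-0#≈0#)

  -- `D` is only required to be equivalent to the denominator, because the univariate factor is
  -- written with q^k and not with 1 times q^k.
  reciprocal-denominator : ∀ v {D} → D ≋ denominator v →
    reciprocal (D ^ₛ suc v) ⊛ (denominator v ^ₛ suc v) ≋ 1ₛ
  reciprocal-denominator v {D} D≋ = SR.begin
    reciprocal (D ^ₛ suc v) ⊛ (denominator v ^ₛ suc v) SR.≈⟨ S.*-congˡ {reciprocal (D ^ₛ suc v)} (^-congˡ (suc v) D≋) ⟨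
    reciprocal (D ^ₛ suc v) ⊛ (D ^ₛ suc v)             SR.≈⟨ S.*-comm (reciprocal (D ^ₛ suc v)) (D ^ₛ suc v) ⟩
    (D ^ₛ suc v) ⊛ reciprocal (D ^ₛ suc v)
      SR.≈⟨ ⊛-reciprocal (D ^ₛ suc v) (^-constantTerm (suc v) (trans (D≋ 0) (denominator-constantTerm v))) ⟩
    1ₛ                                                 SR.∎
    where open Exp S.commutativeSemiring using (^-congˡ)

  constant-^-⊛ : ∀ d f n → ((constant τ ^ₛ d) ⊛ f) n ≈ τ ^ d * f n
  constant-^-⊛ zero    f n = trans (⊛-identityˡ f n) (sym (*-identityˡ (f n)))
  constant-^-⊛ (suc d) f n = begin
    ((constant τ ⊛ (constant τ ^ₛ d)) ⊛ f) n ≈⟨ ⊛-assoc (constant τ) (constant τ ^ₛ d) f n ⟩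
    (constant τ ⊛ ((constant τ ^ₛ d) ⊛ f)) n ≈⟨ constant-⊛ (constant τ) ((constant τ ^ₛ d) ⊛ f) n (λ _ → refl) ⟩
    τ * ((constant τ ^ₛ d) ⊛ f) n            ≈⟨ *-congˡ (constant-^-⊛ d f n) ⟩
    τ * (τ ^ d * f n)                        ≈⟨ *-assoc _ _ _ ⟨
    τ ^ suc d * f n                          ∎

  -- A diagonal choice: coefficient `n` is taken from the finite list of weights below `n`, which is
  -- enough by `sizes-triangle-stable`.
  matrixSeries : Series
  matrixSeries n = sizeSeries (triangleWeights n) n

  module _ (factor : ℕ → Series) (factor-inverse : ∀ i → factor i ⊛ (denominator i ^ₛ suc i) ≋ 1ₛ) where

    product-factor : ∀ M → product {M} (factor ∘ toℕ) ≋ sizeSeries (triangleWeights M)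
    product-factor zero zero    = sym (+-identityʳ 1#)
    product-factor zero (suc n) = refl
    product-factor (suc M) = SR.begin
      product {suc M} (factor ∘ toℕ)
        -- `product` unfolds at its first factor, whereas the induction on `M` has to remove the
        -- last one.
        SR.≈⟨ sum-init-last {M} (factor ∘ toℕ) ⟩
      product {M} (factor ∘ toℕ ∘ inject₁) ⊛ factor (toℕ (fromℕ M))
        SR.≡⟨ cong₂ _⊛_ (sum-cong-≗ {M} (λ i → cong factor (toℕ-inject₁ i))) (cong factor (toℕ-fromℕ M)) ⟩
      product {M} (factor ∘ toℕ) ⊛ factor M
        SR.≈⟨ S.*-comm (product {M} (factor ∘ toℕ)) (factor M) ⟩
      factor M ⊛ product {M} (factor ∘ toℕ)
        SR.≈⟨ S.*-congˡ {factor M} (product-factor M) ⟩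
      factor M ⊛ sizeSeries (triangleWeights M)
        -- The M + 1 new weights of level M are inserted together with their denominators, which
        -- `factor M` then cancels.
        SR.≈⟨ S.*-congˡ {factor M} (denominator^-⊛ (suc M) M (triangleWeights M)) ⟨
      factor M ⊛ ((denominator M ^ₛ suc M) ⊛ sizeSeries (triangleWeights (suc M)))
        SR.≈⟨ S.*-assoc (factor M) (denominator M ^ₛ suc M) _ ⟨
      (factor M ⊛ (denominator M ^ₛ suc M)) ⊛ sizeSeries (triangleWeights (suc M))
        SR.≈⟨ S.*-congʳ {sizeSeries (triangleWeights (suc M))} (factor-inverse M) ⟩
      1ₛ ⊛ sizeSeries (triangleWeights (suc M))
        SR.≈⟨ S.*-identityˡ (sizeSeries (triangleWeights (suc M))) ⟩
      sizeSeries (triangleWeights (suc M)) SR.∎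
      where open MonoidSum S.*-monoid using (sum-init-last; sum-cong-≗)

    isInfiniteProduct : IsInfiniteProduct factor matrixSeries
    isInfiniteProduct n = n , λ M n≤M →
      trans (product-factor M n) (reflexive (cong evaluate (sizes-triangle-stable (ℕ.≤⇒≤′ n≤M))))

-- Finite sums

open import Data.Nat.Base hiding (_^_)
open import Data.Nat.Properties
open import Relation.Binary.PropositionalEquality using (refl; sym; trans)

private
  module Σ = CommutativeMonoidSum +-0-commutativeMonoid
  module Σ* = SemiringSum +-*-semiring

∑ : ℕ → (ℕ → ℕ) → ℕ
∑ n f = Σ.sum {n} (f ∘ toℕ)

∑-cong : ∀ n {f g} → f ≗ g → ∑ n f ≡ ∑ n g
∑-cong n f≗g = Σ.sum-cong-≗ {n} (f≗g ∘ toℕ)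

∑-cong-< : ∀ n {f g} → (∀ i → i < n → f i ≡ g i) → ∑ n f ≡ ∑ n g
∑-cong-< zero    eq = refl
∑-cong-< (suc n) eq = cong₂ _+_ (eq 0 z<s) (∑-cong-< n (λ i i<n → eq (suc i) (s<s i<n)))

∑-distrib-+ : ∀ n f g → ∑ n (λ i → f i + g i) ≡ ∑ n f + ∑ n g
∑-distrib-+ n f g = Σ.∑-distrib-+ {n} (f ∘ toℕ) (g ∘ toℕ)

∑-swap : ∀ m n (f : ℕ → ℕ → ℕ) → ∑ m (λ i → ∑ n (f i)) ≡ ∑ n (λ j → ∑ m (λ i → f i j))
∑-swap m n f = Σ.∑-comm {m} {n} (λ i j → f (toℕ i) (toℕ j))

∑-*-distribˡ : ∀ n x f → x * ∑ n f ≡ ∑ n (λ i → x * f i)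
∑-*-distribˡ n x f = Σ*.*-distribˡ-sum {n} x (f ∘ toℕ)

∑-*-distribʳ : ∀ n x f → ∑ n f * x ≡ ∑ n (λ i → f i * x)
∑-*-distribʳ n x f = Σ*.*-distribʳ-sum {n} x (f ∘ toℕ)

∑-zero : ∀ n {f} → (∀ i → f i ≡ 0) → ∑ n f ≡ 0
∑-zero n f≡0 = trans (∑-cong n f≡0) (Σ.sum-replicate-zero n)

∑-last : ∀ n f → ∑ (suc n) f ≡ ∑ n f + f n
∑-last zero    f = +-identityʳ (f 0)
∑-last (suc n) f = trans (cong (f 0 +_) (∑-last n (f ∘ suc))) (sym (+-assoc (f 0) _ _))

∑-last-zero : ∀ n f → f n ≡ 0 → ∑ (suc n) f ≡ ∑ n f
∑-last-zero n f fn≡0 = trans (∑-last n f) (trans (cong (∑ n f +_) fn≡0) (+-identityʳ _))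

∑-extend : ∀ {n m} f → n ≤ m → (∀ i → n ≤ i → f i ≡ 0) → ∑ m f ≡ ∑ n f
∑-extend {m = m} f z≤n f≡0 = ∑-zero m (λ i → f≡0 i z≤n)
∑-extend f (s≤s n≤m) f≡0 = cong (f 0 +_) (∑-extend (f ∘ suc) n≤m (λ i n≤i → f≡0 (suc i) (s≤s n≤i)))

term≤∑ : ∀ {n i} f → i < n → f i ≤ ∑ n f
term≤∑ {i = zero}  f z<s       = m≤m+n (f 0) _
term≤∑ {i = suc i} f (s<s i<n) = m≤n⇒m≤o+n (f 0) (term≤∑ (f ∘ suc) i<n)

∑∑ : ℕ → (ℕ → ℕ → ℕ) → ℕ
∑∑ n f = ∑ n (λ i → ∑ n (f i))

∑∑-cong : ∀ n {f g : ℕ → ℕ → ℕ} → (∀ i j → f i j ≡ g i j) → ∑∑ n f ≡ ∑∑ n g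
∑∑-cong n eq = ∑-cong n (λ i → ∑-cong n (eq i))

∑∑-cong-< : ∀ n {f g : ℕ → ℕ → ℕ} → (∀ i j → i < n → j < n → f i j ≡ g i j) → ∑∑ n f ≡ ∑∑ n g
∑∑-cong-< n eq = ∑-cong-< n (λ i i<n → ∑-cong-< n (λ j j<n → eq i j i<n j<n))

Vanishing : ℕ → (ℕ → ℕ → ℕ) → Set
Vanishing n f = ∀ i j → n ≤ i ⊎ n ≤ j → f i j ≡ 0

∑∑-extend : ∀ {n m} (f : ℕ → ℕ → ℕ) → n ≤ m → Vanishing n f → ∑∑ m f ≡ ∑∑ n f
∑∑-extend {n} {m} f n≤m f≡0 = trans
  (∑-cong m (λ i → ∑-extend (f i) n≤m (λ j n≤j → f≡0 i j (inj₂ n≤j))))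
  (∑-extend _ n≤m (λ i n≤i → ∑-zero n (λ j → f≡0 i j (inj₁ n≤i))))

∑-telescope : ∀ n (S R : ℕ → ℕ) → (∀ d → S d ≡ S (suc d) + R d) → S n ≡ 0 → S 0 ≡ ∑ n R
∑-telescope zero    S R eq Sn≡0 = Sn≡0
∑-telescope (suc n) S R eq Sn≡0 = begin
  S 0              ≡⟨ eq 0 ⟩
  S 1 + R 0        ≡⟨ +-comm (S 1) (R 0) ⟩
  R 0 + S 1        ≡⟨ cong (R 0 +_) (∑-telescope n (S ∘ suc) (R ∘ suc) (eq ∘ suc) Sn≡0) ⟩
  ∑ (suc n) R      ∎
  where open ≡-Reasoning

-- Abel summation: `S d` is the tail of the sum of `R` from `d` on, so `R i` occurs in `S 1`, ...,
-- `S i`, that is, i times.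
∑-by-parts : ∀ n (S R : ℕ → ℕ) → (∀ d → S d ≡ S (suc d) + R d) → S n ≡ 0 →
             ∑ n (S ∘ suc) ≡ ∑ n (λ i → i * R i)
∑-by-parts zero    S R eq Sn≡0 = refl
∑-by-parts (suc n) S R eq Sn≡0 = begin
  S 1 + ∑ n (λ d → S (suc (suc d)))
    ≡⟨ cong₂ _+_ (∑-telescope n (S ∘ suc) (R ∘ suc) (eq ∘ suc) Sn≡0)
                 (∑-by-parts n (S ∘ suc) (R ∘ suc) (eq ∘ suc) Sn≡0) ⟩
  ∑ n (R ∘ suc) + ∑ n (λ i → i * R (suc i))
    ≡⟨ ∑-distrib-+ n (R ∘ suc) (λ i → i * R (suc i)) ⟨
  ∑ n (λ i → suc i * R (suc i)) ∎
  where open ≡-Reasoning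

-- Induction strips row 0 and column 0, the hook of the corner. As `f` vanishes outside the square,
-- the shorter hooks further down may also be summed up to `n`. With `d` fixed and `r` varying, the
-- summands run along diagonals.
∑∑-diagonals : ∀ n (f : ℕ → ℕ → ℕ) → Vanishing n f →
  ∑∑ n f ≡ ∑ n (λ r → f r r + (∑ n (λ d → f (r + suc d) r) + ∑ n (λ d → f r (r + suc d))))
∑∑-diagonals zero    f f≡0 = refl
∑∑-diagonals (suc n) f f≡0 = begin
  (f 0 0 + row) + ∑ n (λ i → f (suc i) 0 + ∑ n (f′ i))
    ≡⟨ cong ((f 0 0 + row) +_) (∑-distrib-+ n (λ i → f (suc i) 0) (λ i → ∑ n (f′ i))) ⟩
  (f 0 0 + row) + (column + ∑∑ n f′)
    ≡⟨ regroup (f 0 0) row column (∑∑ n f′) ⟩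
  (f 0 0 + (column + row)) + ∑∑ n f′
    ≡⟨ cong₂ (λ x y → (f 0 0 + x) + y)
         (cong₂ _+_ (∑-last-zero n (λ d → f (suc d) 0) (f≡0 (suc n) 0 (inj₁ ≤-refl)))
                    (∑-last-zero n (λ d → f 0 (suc d)) (f≡0 0 (suc n) (inj₂ ≤-refl))))
         (trans
           (∑-cong n (λ r → cong (f (suc r) (suc r) +_) (cong₂ _+_
             (∑-last-zero n (λ d → f (suc r + suc d) (suc r))
               (f≡0 (suc r + suc n) (suc r) (inj₁ (m≤n+m (suc n) (suc r)))))
             (∑-last-zero n (λ d → f (suc r) (suc r + suc d))
               (f≡0 (suc r) (suc r + suc n) (inj₂ (m≤n+m (suc n) (suc r))))))))
           (sym (∑∑-diagonals n f′ f′≡0))) ⟨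
  ∑ (suc n) (λ r → f r r + (∑ (suc n) (λ d → f (r + suc d) r) + ∑ (suc n) (λ d → f r (r + suc d)))) ∎
  where
  open ≡-Reasoning
  row = ∑ n (λ j → f 0 (suc j))
  column = ∑ n (λ i → f (suc i) 0)
  f′ = λ i j → f (suc i) (suc j)
  f′≡0 : Vanishing n f′
  f′≡0 i j (inj₁ n≤i) = f≡0 (suc i) (suc j) (inj₁ (s≤s n≤i))
  f′≡0 i j (inj₂ n≤j) = f≡0 (suc i) (suc j) (inj₂ (s≤s n≤j))
  regroup : ∀ a b c d → (a + b) + (c + d) ≡ (a + (c + b)) + d
  regroup = solve-∀

δ : ℕ → ℕ → ℕ
δ zero    zero    = 1
δ zero    (suc j) = 0
δ (suc i) zero    = 0
δ (suc i) (suc j) = δ i j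

δ-refl : ∀ i → δ i i ≡ 1
δ-refl zero    = refl
δ-refl (suc i) = δ-refl i

δ-≢ : ∀ {i j} → i ≢ j → δ i j ≡ 0
δ-≢ {zero}  {zero}  i≢j = contradiction refl i≢j
δ-≢ {zero}  {suc j} i≢j = refl
δ-≢ {suc i} {zero}  i≢j = refl
δ-≢ {suc i} {suc j} i≢j = δ-≢ (i≢j ∘ cong suc)

∑-δ : ∀ {n k} (f : ℕ → ℕ) → k < n → ∑ n (λ i → δ k i * f i) ≡ f k
∑-δ {suc n} {zero}  f z<s       = trans (cong₂ _+_ (+-identityʳ (f 0)) (∑-zero n (λ _ → refl))) (+-identityʳ (f 0))
∑-δ {suc n} {suc k} f (s<s k<n) = ∑-δ (f ∘ suc) k<n

sum-map-upTo : ∀ (f : ℕ → ℕ) n → ListAction.sum (map f (upTo n)) ≡ ∑ n f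
sum-map-upTo f n = trans (cong ListAction.sum (map-upTo f n)) (sum-applyUpTo f n)
  where
  sum-applyUpTo : ∀ f n → ListAction.sum (applyUpTo f n) ≡ ∑ n f
  sum-applyUpTo f zero    = refl
  sum-applyUpTo f (suc n) = cong (f 0 +_) (sum-applyUpTo (f ∘ suc) n)

sum-map-cartesianProduct : ∀ {A B : Set} (f : A × B → ℕ) (xs : List A) (ys : List B) →
  ListAction.sum (map f (cartesianProduct xs ys)) ≡
  ListAction.sum (map (λ x → ListAction.sum (map (λ y → f (x , y)) ys)) xs)
sum-map-cartesianProduct f []       ys = refl
sum-map-cartesianProduct f (x ∷ xs) ys = begin
  ListAction.sum (map f (map (x ,_) ys ++ cartesianProduct xs ys))
    ≡⟨ cong ListAction.sum (map-++ f (map (x ,_) ys) _) ⟩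
  ListAction.sum (map f (map (x ,_) ys) ++ map f (cartesianProduct xs ys))
    ≡⟨ sum-++ (map f (map (x ,_) ys)) _ ⟩
  ListAction.sum (map f (map (x ,_) ys)) + ListAction.sum (map f (cartesianProduct xs ys))
    ≡⟨ cong₂ _+_ (cong ListAction.sum (sym (map-∘ ys))) (sum-map-cartesianProduct f xs ys) ⟩
  ListAction.sum (map (λ x → ListAction.sum (map (λ y → f (x , y)) ys)) (x ∷ xs)) ∎
  where open ≡-Reasoning

sum-map-square : ∀ (f : ℕ × ℕ → ℕ) n →
  ListAction.sum (map f (cartesianProduct (upTo n) (upTo n))) ≡ ∑∑ n (curry f)
sum-map-square f n = begin
  ListAction.sum (map f (cartesianProduct (upTo n) (upTo n)))
    ≡⟨ sum-map-cartesianProduct f (upTo n) (upTo n) ⟩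
  ListAction.sum (map (λ i → ListAction.sum (map (λ j → f (i , j)) (upTo n))) (upTo n))
    ≡⟨ cong ListAction.sum (map-cong (λ i → sum-map-upTo (curry f i) n) (upTo n)) ⟩
  ListAction.sum (map (λ i → ∑ n (curry f i)) (upTo n))
    ≡⟨ sum-map-upTo _ n ⟩
  ∑∑ n (curry f) ∎
  where open ≡-Reasoning

χ : ∀ {P : Set} → Dec P → ℕ
χ (yes _) = 1
χ (no  _) = 0

χ-cong : ∀ {P Q : Set} (P? : Dec P) (Q? : Dec Q) → (P → Q) → (Q → P) → χ P? ≡ χ Q?
χ-cong (yes p) (yes q) f g = refl
χ-cong (yes p) (no ¬q) f g = contradiction (f p) ¬q
χ-cong (no ¬p) (yes q) f g = contradiction (g q) ¬p
χ-cong (no ¬p) (no ¬q) f g = refl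

sum-map-filter : ∀ {A : Set} {P : Pred A _} (P? : Decidable P) (f : A → ℕ) xs →
  ListAction.sum (map f (filter P? xs)) ≡ ListAction.sum (map (λ x → χ (P? x) * f x) xs)
sum-map-filter P? f [] = refl
sum-map-filter P? f (x ∷ xs) with P? x
... | yes _ = cong₂ _+_ (sym (+-identityʳ (f x))) (sum-map-filter P? f xs)
... | no  _ = sum-map-filter P? f xs

length≡sum : ∀ {A : Set} (xs : List A) → length xs ≡ ListAction.sum (map (λ _ → 1) xs)
length≡sum []       = refl
length≡sum (x ∷ xs) = cong suc (length≡sum xs)

-- Growths

Sequence : Set
Sequence = ℕ → ℕ

infix 4 _≺_

-- Interlacing, κ 0 ≥ μ 0 ≥ κ 1 ≥ μ 1 ≥ ⋯ , so that κ / μ is a horizontal strip. Both sequences are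
-- then weakly decreasing.
_≺_ : Sequence → Sequence → Set
μ ≺ κ = (∀ r → μ r ≤ κ r) × (∀ r → κ (suc r) ≤ μ r)

0ˢ : Sequence
0ˢ _ = 0

0≺0 : 0ˢ ≺ 0ˢ
0≺0 = (λ _ → z≤n) , (λ _ → z≤n)

-- For a square of partitions with ν below λ′ and μ, and these below κ, interlacing says exactly
-- that `ν r` and `κ (suc r)` lie between `lower λ′ μ r` and `upper λ′ μ r`.
lower upper : Sequence → Sequence → Sequence
lower λ′ μ r = λ′ (suc r) ⊔ μ (suc r)
upper λ′ μ r = λ′ r ⊓ μ r

-- The reflection of the interval from `l` to `u`, an involution there. It is the piecewise linear
-- toggle from which the local rule is built.
reflect : ℕ → ℕ → ℕ → ℕ
reflect l u x = u + l ∸ x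

reflect-≤ : ∀ {l u x} → l ≤ x → reflect l u x ≤ u
reflect-≤ {l} {u} {x} l≤x = ≤-trans (∸-monoʳ-≤ (u + l) l≤x) (≤-reflexive (m+n∸n≡m u l))

reflect-≥ : ∀ {l u x} → x ≤ u → l ≤ reflect l u x
reflect-≥ {l} {u} {x} x≤u = ≤-trans (≤-reflexive (sym (m+n∸m≡n u l))) (∸-monoʳ-≤ (u + l) x≤u)

reflect-+ : ∀ {l u x} → x ≤ u → reflect l u x + x ≡ u + l
reflect-+ {l} {u} x≤u = m∸n+n≡m (≤-trans x≤u (m≤m+n u l))

lower≤ : ∀ {λ′ μ ν} → ν ≺ λ′ → ν ≺ μ → ∀ r → lower λ′ μ r ≤ ν r
lower≤ ν≺λ ν≺μ r = ⊔-lub (proj₂ ν≺λ r) (proj₂ ν≺μ r)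

≤upper : ∀ {λ′ μ ν} → ν ≺ λ′ → ν ≺ μ → ∀ r → ν r ≤ upper λ′ μ r
≤upper ν≺λ ν≺μ r = ⊓-glb (proj₁ ν≺λ r) (proj₁ ν≺μ r)

-- The forward local rule: the matrix entry `m` goes into the first part, and each later part is a
-- reflected part of `ν`.
above : ℕ → Sequence → Sequence → Sequence → Sequence
above m λ′ μ ν zero    = (λ′ 0 ⊔ μ 0) + m
above m λ′ μ ν (suc r) = reflect (lower λ′ μ r) (upper λ′ μ r) (ν r)

above-≻ : ∀ {m λ′ μ ν} → ν ≺ λ′ → ν ≺ μ → λ′ ≺ above m λ′ μ ν × μ ≺ above m λ′ μ ν
above-≻ {m} {λ′} {μ} {ν} ν≺λ ν≺μ =
  ((λ { zero    → ≤-trans (m≤m⊔n (λ′ 0) (μ 0)) (m≤m+n _ m)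
      ; (suc r) → ≤-trans (m≤m⊔n (λ′ (suc r)) (μ (suc r))) (below r) }) ,
   (λ r → ≤-trans (reflect-≤ (lower≤ ν≺λ ν≺μ r)) (m⊓n≤m (λ′ r) (μ r)))) ,
  ((λ { zero    → ≤-trans (m≤n⊔m (λ′ 0) (μ 0)) (m≤m+n _ m)
      ; (suc r) → ≤-trans (m≤n⊔m (λ′ (suc r)) (μ (suc r))) (below r) }) ,
   (λ r → ≤-trans (reflect-≤ (lower≤ ν≺λ ν≺μ r)) (m⊓n≤n (λ′ r) (μ r))))
  where
  below : ∀ r → lower λ′ μ r ≤ above m λ′ μ ν (suc r)
  below r = reflect-≥ (≤upper ν≺λ ν≺μ r)

-- The backward local rule, given by the same reflections; the matrix entry is recovered separately
-- from the first parts.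
beneath : Sequence → Sequence → Sequence → Sequence
beneath κ λ′ μ r = reflect (lower λ′ μ r) (upper λ′ μ r) (κ (suc r))

module _ {κ λ′ μ : Sequence} (λ≺κ : λ′ ≺ κ) (μ≺κ : μ ≺ κ) where
  suc≤upper : ∀ r → κ (suc r) ≤ upper λ′ μ r
  suc≤upper r = ⊓-glb (proj₂ λ≺κ r) (proj₂ μ≺κ r)

  beneath-≺ : beneath κ λ′ μ ≺ λ′ × beneath κ λ′ μ ≺ μ
  beneath-≺ =
    ((λ r → ≤-trans (≤u r) (m⊓n≤m (λ′ r) (μ r))) ,
     (λ r → ≤-trans (m≤m⊔n (λ′ (suc r)) (μ (suc r))) (l≤ r))) ,
    ((λ r → ≤-trans (≤u r) (m⊓n≤n (λ′ r) (μ r))) ,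
     (λ r → ≤-trans (m≤n⊔m (λ′ (suc r)) (μ (suc r))) (l≤ r)))
    where
    ≤u : ∀ r → beneath κ λ′ μ r ≤ upper λ′ μ r
    ≤u r = reflect-≤ (⊔-lub (proj₁ λ≺κ (suc r)) (proj₁ μ≺κ (suc r)))
    l≤ : ∀ r → lower λ′ μ r ≤ beneath κ λ′ μ r
    l≤ r = reflect-≥ (suc≤upper r)

Matrix : Set
Matrix = ℕ → ℕ → ℕ

-- first and later are the local rule; the interlacing conditions down and right
-- make later solvable for L i j (suc r) and for L (suc i) (suc j) r.

record Growth (a : Matrix) (L : ℕ → ℕ → Sequence) : Set where
  field
    down  : ∀ i j → L (suc i) j ≺ L i j
    right : ∀ i j → L i (suc j) ≺ L i j
    first : ∀ i j → L i j 0 ≡ (L (suc i) j 0 ⊔ L i (suc j) 0) + a i j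
    later : ∀ i j r → L i j (suc r) + L (suc i) (suc j) r ≡
                      upper (L (suc i) j) (L i (suc j)) r + lower (L (suc i) j) (L i (suc j)) r
    bound : ℕ
    empty : ∀ i j → bound ≤ i ⊎ bound ≤ j → ∀ r → L i j r ≡ 0

open Growth

-- The local rule is symmetric in its two middle partitions, so facts proved for rows hold for
-- columns.
transpose : ∀ {a L} → Growth a L → Growth (flip a) (flip L)
transpose {a} {L} G = record
  { down  = flip (right G)
  ; right = flip (down G)
  ; first = λ i j → trans (first G j i) (cong (_+ a j i) (⊔-comm (L (suc j) i 0) (L j (suc i) 0)))
  ; later = λ i j r → trans (later G j i r)
      (cong₂ _+_ (⊓-comm (L (suc j) i r) (L j (suc i) r)) (⊔-comm (L (suc j) i (suc r)) (L j (suc i) (suc r))))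
  ; bound = bound G
  ; empty = λ i j → empty G j i ∘ Sum.swap
  }

inside-or-outside : ∀ n i j → (i < n × j < n) ⊎ (n ≤ i ⊎ n ≤ j)
inside-or-outside n i j with i <? n | j <? n
... | yes i<n | yes j<n = inj₁ (i<n , j<n)
... | no  i≮n | _       = inj₂ (inj₁ (≮⇒≥ i≮n))
... | _       | no  j≮n = inj₂ (inj₂ (≮⇒≥ j≮n))

module _ (a : Matrix) where
  -- grow u v i j is the partition at (i, j) grown from the entries of a in the
  -- u rows from i on and the v columns from j on.

  grow : ℕ → ℕ → ℕ → ℕ → Sequence
  grow zero    v       i j = 0ˢ
  grow (suc u) zero    i j = 0ˢ
  grow (suc u) (suc v) i j = above (a i j) (grow u (suc v) (suc i) j) (grow (suc u) v i (suc j)) (grow u v (suc i) (suc j))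

  mutual
    -- The local rule preserves interlacing if the opposite corner interlaces with both middle
    -- partitions. One of these is a vertical relation and the other a horizontal one, hence the
    -- mutual induction.
    grow-down : ∀ u v i j → grow u v (suc i) j ≺ grow (suc u) v i j
    grow-down zero    zero    i j = 0≺0
    grow-down (suc u) zero    i j = 0≺0
    grow-down u       (suc v) i j = proj₁ (above-≻ {a i j} (grow-right u v (suc i) j) (grow-down u v i (suc j)))

    grow-right : ∀ u v i j → grow u v i (suc j) ≺ grow u (suc v) i j
    grow-right zero    v i j = 0≺0
    grow-right (suc u) v i j = proj₂ (above-≻ {a i j} (grow-right u v (suc i) j) (grow-down u v i (suc j)))

  grow-zeroʳ : ∀ u i j → grow u 0 i j ≡ 0ˢ
  grow-zeroʳ zero    i j = refl
  grow-zeroʳ (suc u) i j = refl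

  module _ (n : ℕ) where
    -- From (i, j) there are `n ∸ i` rows and `n ∸ j` columns left in the square, so the recursive
    -- calls of `grow` are the values of `matrixGrowth` at the neighbours.
    matrixGrowth : ℕ → ℕ → Sequence
    matrixGrowth i j = grow (n ∸ i) (n ∸ j) i j

    matrixGrowth-emptyˡ : ∀ {i} j → n ≤ i → matrixGrowth i j ≡ 0ˢ
    matrixGrowth-emptyˡ {i} j n≤i = cong (λ u → grow u (n ∸ j) i j) (m≤n⇒m∸n≡0 n≤i)

    matrixGrowth-emptyʳ : ∀ i {j} → n ≤ j → matrixGrowth i j ≡ 0ˢ
    matrixGrowth-emptyʳ i {j} n≤j = trans (cong (λ v → grow (n ∸ i) v i j) (m≤n⇒m∸n≡0 n≤j)) (grow-zeroʳ (n ∸ i) i j)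

    pred-∸ : ∀ {i} → i < n → n ∸ i ≡ suc (n ∸ suc i)
    pred-∸ = +-∸-assoc 1

    matrixGrowth-above : ∀ {i j} → i < n → j < n →
      matrixGrowth i j ≡ above (a i j) (matrixGrowth (suc i) j) (matrixGrowth i (suc j)) (matrixGrowth (suc i) (suc j))
    matrixGrowth-above {i} {j} i<n j<n rewrite pred-∸ i<n | pred-∸ j<n = refl

    matrixGrowth-down : ∀ i j → matrixGrowth (suc i) j ≺ matrixGrowth i j
    matrixGrowth-down i j with i <? n
    ... | yes i<n rewrite pred-∸ i<n = grow-down (n ∸ suc i) (n ∸ j) i j
    ... | no  i≮n = subst₂ _≺_ (sym (matrixGrowth-emptyˡ j (m≤n⇒m≤1+n (≮⇒≥ i≮n))))
                               (sym (matrixGrowth-emptyˡ j (≮⇒≥ i≮n))) 0≺0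

    matrixGrowth-right : ∀ i j → matrixGrowth i (suc j) ≺ matrixGrowth i j
    matrixGrowth-right i j with j <? n
    ... | yes j<n rewrite pred-∸ j<n = grow-right (n ∸ i) (n ∸ suc j) i j
    ... | no  j≮n = subst₂ _≺_ (sym (matrixGrowth-emptyʳ i (m≤n⇒m≤1+n (≮⇒≥ j≮n))))
                               (sym (matrixGrowth-emptyʳ i (≮⇒≥ j≮n))) 0≺0

    matrixGrowth-empty : ∀ i j → n ≤ i ⊎ n ≤ j → matrixGrowth i j ≡ 0ˢ
    matrixGrowth-empty i j (inj₁ n≤i) = matrixGrowth-emptyˡ j n≤i
    matrixGrowth-empty i j (inj₂ n≤j) = matrixGrowth-emptyʳ i n≤j

    -- Growth inside the square sees only the entries there, so the growth obtained is that of the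
    -- truncated matrix, for arbitrary `a`.
    restrict : Matrix
    restrict i j with inside-or-outside n i j
    ... | inj₁ _ = a i j
    ... | inj₂ _ = 0

    restrict-inside : ∀ {i j} → i < n → j < n → restrict i j ≡ a i j
    restrict-inside {i} {j} i<n j<n with inside-or-outside n i j
    ... | inj₁ _          = refl
    ... | inj₂ (inj₁ n≤i) = contradiction i<n (≤⇒≯ n≤i)
    ... | inj₂ (inj₂ n≤j) = contradiction j<n (≤⇒≯ n≤j)

    restrict-vanishing : Vanishing n a → ∀ i j → restrict i j ≡ a i j
    restrict-vanishing a≡0 i j with inside-or-outside n i j
    ... | inj₁ _   = refl
    ... | inj₂ out = sym (a≡0 i j out)

    matrixGrowth-isGrowth : Growth restrict matrixGrowth
    matrixGrowth-isGrowth = record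
      { down  = matrixGrowth-down
      ; right = matrixGrowth-right
      ; first = first′
      ; later = later′
      ; bound = n
      ; empty = λ i j out r → cong (λ κ → κ r) (matrixGrowth-empty i j out)
      }
      where
      L = matrixGrowth
      stillˡ : ∀ {i j} → n ≤ i ⊎ n ≤ j → n ≤ suc i ⊎ n ≤ j
      stillˡ = Sum.map₁ m≤n⇒m≤1+n
      stillʳ : ∀ {i j} → n ≤ i ⊎ n ≤ j → n ≤ i ⊎ n ≤ suc j
      stillʳ = Sum.map₂ m≤n⇒m≤1+n
      first′ : ∀ i j → L i j 0 ≡ (L (suc i) j 0 ⊔ L i (suc j) 0) + restrict i j
      first′ i j with inside-or-outside n i j
      ... | inj₁ (i<n , j<n) = cong (λ κ → κ 0) (matrixGrowth-above i<n j<n)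
      ... | inj₂ out
        rewrite matrixGrowth-empty i j out | matrixGrowth-empty (suc i) j (stillˡ out)
              | matrixGrowth-empty i (suc j) (stillʳ out) = refl
      later′ : ∀ i j r → L i j (suc r) + L (suc i) (suc j) r ≡
                         upper (L (suc i) j) (L i (suc j)) r + lower (L (suc i) j) (L i (suc j)) r
      later′ i j r with inside-or-outside n i j
      ... | inj₁ (i<n , j<n) = trans (cong (λ κ → κ (suc r) + L (suc i) (suc j) r) (matrixGrowth-above i<n j<n))
                                 (reflect-+ (≤upper (matrixGrowth-right (suc i) j) (matrixGrowth-down i (suc j)) r))
      ... | inj₂ out
        rewrite matrixGrowth-empty i j out | matrixGrowth-empty (suc i) j (stillˡ out)
              | matrixGrowth-empty i (suc j) (stillʳ out)
              | matrixGrowth-empty (suc i) (suc j) (stillʳ (stillˡ out)) = refl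

restrict-cong : ∀ {a b n} → (∀ i j → i < n → j < n → a i j ≡ b i j) → ∀ i j → restrict a n i j ≡ restrict b n i j
restrict-cong {n = n} a≡b i j with inside-or-outside n i j
... | inj₁ (i<n , j<n) = a≡b i j i<n j<n
... | inj₂ _           = refl

-- Induction towards the origin from the region outside the square; `u` and `v` bound the number of
-- rows and columns still to be crossed.
descend : (P : ℕ → ℕ → Set) (n : ℕ) → (∀ i j → n ≤ i ⊎ n ≤ j → P i j) →
          (∀ i j → P (suc i) j → P i (suc j) → P (suc i) (suc j) → P i j) → ∀ i j → P i j
descend P n out step i j = go n n i j (m≤m+n n i) (m≤m+n n j)
  where
  go : ∀ u v i j → n ≤ u + i → n ≤ v + j → P i j
  go zero    v       i j n≤i n≤j = out i j (inj₁ n≤i)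
  go (suc u) zero    i j n≤i n≤j = out i j (inj₂ n≤j)
  go (suc u) (suc v) i j n≤i n≤j = step i j
    (go u (suc v) (suc i) j n≤u+1+i n≤j)
    (go (suc u) v i (suc j) n≤i n≤v+1+j)
    (go u v (suc i) (suc j) n≤u+1+i n≤v+1+j)
    where
    n≤u+1+i = ≤-trans n≤i (≤-reflexive (sym (+-suc u i)))
    n≤v+1+j = ≤-trans n≤j (≤-reflexive (sym (+-suc v j)))

module _ {a a′ L L′} (G : Growth a L) (G′ : Growth a′ L′) where

  -- The forward reading of the local rule: cancelling the opposite corner in `later` leaves
  -- `L i j (suc r)` determined.
  growth-unique : (∀ i j → a i j ≡ a′ i j) → ∀ i j r → L i j r ≡ L′ i j r
  growth-unique a≡a′ = descend (λ i j → ∀ r → L i j r ≡ L′ i j r) (bound G ⊔ bound G′)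
    (λ i j out r → trans
      (empty G i j (Sum.map (≤-trans (m≤m⊔n _ _)) (≤-trans (m≤m⊔n _ _)) out) r)
      (sym (empty G′ i j (Sum.map (≤-trans (m≤n⊔m (bound G) _)) (≤-trans (m≤n⊔m (bound G) _)) out) r)))
    (λ i j below beside opposite → λ
      { zero    → begin
          L i j 0                                    ≡⟨ first G i j ⟩
          (L (suc i) j 0 ⊔ L i (suc j) 0) + a i j    ≡⟨ cong₂ _+_ (cong₂ _⊔_ (below 0) (beside 0)) (a≡a′ i j) ⟩
          (L′ (suc i) j 0 ⊔ L′ i (suc j) 0) + a′ i j ≡⟨ first G′ i j ⟨
          L′ i j 0                                   ∎
      ; (suc r) → +-cancelʳ-≡ (L (suc i) (suc j) r) _ _ (begin
          L i j (suc r) + L (suc i) (suc j) r   ≡⟨ later G i j r ⟩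
          upper (L (suc i) j) (L i (suc j)) r + lower (L (suc i) j) (L i (suc j)) r
            ≡⟨ cong₂ _+_ (cong₂ _⊓_ (below r) (beside r)) (cong₂ _⊔_ (below (suc r)) (beside (suc r))) ⟩
          upper (L′ (suc i) j) (L′ i (suc j)) r + lower (L′ (suc i) j) (L′ i (suc j)) r
            ≡⟨ later G′ i j r ⟨
          L′ i j (suc r) + L′ (suc i) (suc j) r ≡⟨ cong (L′ i j (suc r) +_) (opposite r) ⟨
          L′ i j (suc r) + L (suc i) (suc j) r  ∎)
      })
    where open ≡-Reasoning

  -- The backward reading: cancelling `L i j (suc r)` in `later` leaves the partition at (i + 1, j +
  -- 1) determined, so the two sides at 0 suffice.
  boundary-unique : (∀ i r → L i 0 r ≡ L′ i 0 r) → (∀ j r → L 0 j r ≡ L′ 0 j r) →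
                    ∀ i j r → L i j r ≡ L′ i j r
  boundary-unique left top i       zero    = left i
  boundary-unique left top zero    (suc j) = top (suc j)
  boundary-unique left top (suc i) (suc j) r = +-cancelˡ-≡ (L i j (suc r)) _ _ (begin
    L i j (suc r) + L (suc i) (suc j) r   ≡⟨ later G i j r ⟩
    upper (L (suc i) j) (L i (suc j)) r + lower (L (suc i) j) (L i (suc j)) r
      ≡⟨ cong₂ _+_ (cong₂ _⊓_ (below r) (beside r)) (cong₂ _⊔_ (below (suc r)) (beside (suc r))) ⟩
    upper (L′ (suc i) j) (L′ i (suc j)) r + lower (L′ (suc i) j) (L′ i (suc j)) r
      ≡⟨ later G′ i j r ⟨
    L′ i j (suc r) + L′ (suc i) (suc j) r ≡⟨ cong (_+ L′ (suc i) (suc j) r) (boundary-unique left top i j (suc r)) ⟨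
    L i j (suc r) + L′ (suc i) (suc j) r  ∎)
    where
    open ≡-Reasoning
    below  = boundary-unique left top (suc i) j
    beside = boundary-unique left top i (suc j)

  -- It asks only about first parts, so it serves both the diagonals and the last passage array.
  matrix-unique : (∀ i j → L i j 0 ≡ L′ i j 0) → ∀ i j → a i j ≡ a′ i j
  matrix-unique L≡L′ i j = +-cancelˡ-≡ (L (suc i) j 0 ⊔ L i (suc j) 0) _ _ (begin
    (L (suc i) j 0 ⊔ L i (suc j) 0) + a i j    ≡⟨ first G i j ⟨
    L i j 0                                    ≡⟨ L≡L′ i j ⟩
    L′ i j 0                                   ≡⟨ first G′ i j ⟩
    (L′ (suc i) j 0 ⊔ L′ i (suc j) 0) + a′ i j ≡⟨ cong (_+ a′ i j) (cong₂ _⊔_ (L≡L′ (suc i) j) (L≡L′ i (suc j))) ⟨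
    (L (suc i) j 0 ⊔ L i (suc j) 0) + a′ i j   ∎)
    where open ≡-Reasoning

module GrowthProperties {a L} (G : Growth a L) where
  matrix-vanishing : Vanishing (bound G) a
  matrix-vanishing i j out = n≤0⇒n≡0 (≤-trans (m≤n+m (a i j) _)
    (≤-reflexive (trans (sym (first G i j)) (empty G i j out 0))))

  -- Interlacing bounds a later part by the preceding part one row down; `r` such steps reach a
  -- first part. Hence each partition has at most `bound G` nonzero parts.
  antidiagonal-≤ : ∀ r i j → L i j r ≤ L (r + i) j 0
  antidiagonal-≤ zero    i j = ≤-refl
  antidiagonal-≤ (suc r) i j = ≤-trans (proj₂ (down G i j) r)
    (≤-trans (antidiagonal-≤ r (suc i) j) (≤-reflexive (cong (λ k → L k j 0) (+-suc r i))))

  late-zero : ∀ {r i} j → bound G ≤ r + i → L i j r ≡ 0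
  late-zero {r} {i} j n≤r+i =
    n≤0⇒n≡0 (≤-trans (antidiagonal-≤ r i j) (≤-reflexive (empty G (r + i) j (inj₁ n≤r+i) 0)))

  total : ℕ → ℕ → ℕ
  total i j = ∑ (bound G) (L i j)

  -- Summed over r, `later` contributes all minima and all maxima except the one at 0, and `first`
  -- supplies that one together with `a i j`. Minimum plus maximum is the plain sum.
  local-total : ∀ i j → total i j + total (suc i) (suc j) ≡ total (suc i) j + total i (suc j) + a i j
  local-total i j = begin
    ∑ n κ + ∑ n ν
      -- One more vanishing part of `κ` is added, so that `κ (suc r)` pairs with `ν r` for all r <
      -- n.
      ≡⟨ cong (_+ ∑ n ν) (∑-last-zero n κ (late-zero j (m≤m+n n i))) ⟨
    κ 0 + ∑ n (κ ∘ suc) + ∑ n ν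
      ≡⟨ +-assoc (κ 0) _ _ ⟩
    κ 0 + (∑ n (κ ∘ suc) + ∑ n ν)
      ≡⟨ cong (κ 0 +_) (∑-distrib-+ n (κ ∘ suc) ν) ⟨
    κ 0 + ∑ n (λ r → κ (suc r) + ν r)
      ≡⟨ cong₂ _+_ (first G i j) (∑-cong n (later G i j)) ⟩
    λ′ 0 ⊔ μ 0 + a i j + ∑ n (λ r → upper λ′ μ r + lower λ′ μ r)
      ≡⟨ cong (λ′ 0 ⊔ μ 0 + a i j +_) (∑-distrib-+ n (upper λ′ μ) (lower λ′ μ)) ⟩
    λ′ 0 ⊔ μ 0 + a i j + (∑ n (upper λ′ μ) + ∑ n (lower λ′ μ))
      ≡⟨ regroup (λ′ 0 ⊔ μ 0) (a i j) (∑ n (upper λ′ μ)) (∑ n (lower λ′ μ)) ⟩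
    ∑ n (upper λ′ μ) + ∑ (suc n) (λ r → λ′ r ⊔ μ r) + a i j
      ≡⟨ cong (λ x → ∑ n (upper λ′ μ) + x + a i j) (∑-last-zero n (λ r → λ′ r ⊔ μ r)
           (cong₂ _⊔_ (late-zero j (m≤m+n n (suc i))) (late-zero (suc j) (m≤m+n n i)))) ⟩
    ∑ n (upper λ′ μ) + ∑ n (λ r → λ′ r ⊔ μ r) + a i j
      ≡⟨ cong (_+ a i j) (∑-distrib-+ n (upper λ′ μ) (λ r → λ′ r ⊔ μ r)) ⟨
    ∑ n (λ r → λ′ r ⊓ μ r + (λ′ r ⊔ μ r)) + a i j
      ≡⟨ cong (_+ a i j) (∑-cong n (λ r → ⊓+⊔ (λ′ r) (μ r))) ⟩
    ∑ n (λ r → λ′ r + μ r) + a i j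
      ≡⟨ cong (_+ a i j) (∑-distrib-+ n λ′ μ) ⟩
    ∑ n λ′ + ∑ n μ + a i j ∎
    where
    open ≡-Reasoning
    n = bound G
    κ = L i j
    λ′ = L (suc i) j
    μ = L i (suc j)
    ν = L (suc i) (suc j)
    regroup : ∀ m x u l → m + x + (u + l) ≡ u + (m + l) + x
    regroup = solve-∀
    ⊓+⊔ : ∀ x y → x ⊓ y + (x ⊔ y) ≡ x + y
    ⊓+⊔ x y with ≤-total x y
    ... | inj₁ x≤y = cong₂ _+_ (m≤n⇒m⊓n≡m x≤y) (m≤n⇒m⊔n≡n x≤y)
    ... | inj₂ y≤x = trans (cong₂ _+_ (m≥n⇒m⊓n≡n y≤x) (m≥n⇒m⊔n≡m y≤x)) (+-comm y x)

  -- `local-total` is added up along row `i`; the intermediate sizes cancel, and the partitions at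
  -- column `bound G` are empty.
  total-row : ∀ i → total i 0 ≡ total (suc i) 0 + ∑ (bound G) (a i)
  total-row i = +-cancelʳ-≡ (total (suc i) n) _ _ (begin
    total i 0 + total (suc i) n                            ≡⟨ partial n ⟩
    total (suc i) 0 + total i n + ∑ n (a i)                ≡⟨ cong (λ x → total (suc i) 0 + x + ∑ n (a i)) (blank i) ⟩
    total (suc i) 0 + 0 + ∑ n (a i)                        ≡⟨ cong (_+ ∑ n (a i)) (+-identityʳ _) ⟩
    total (suc i) 0 + ∑ n (a i)                            ≡⟨ +-identityʳ _ ⟨
    total (suc i) 0 + ∑ n (a i) + 0                        ≡⟨ cong (total (suc i) 0 + ∑ n (a i) +_) (blank (suc i)) ⟨
    total (suc i) 0 + ∑ n (a i) + total (suc i) n          ∎)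
    where
    open ≡-Reasoning
    n = bound G
    blank : ∀ i → total i n ≡ 0
    blank i = ∑-zero n (empty G i n (inj₂ ≤-refl))
    partial : ∀ m → total i 0 + total (suc i) m ≡ total (suc i) 0 + total i m + ∑ m (a i)
    partial zero    = trans (+-comm (total i 0) _) (sym (+-identityʳ _))
    partial (suc m) = +-cancelʳ-≡ (total i m) _ _ (begin
      total i 0 + total (suc i) (suc m) + total i m
        ≡⟨ trans (+-assoc (total i 0) _ _) (cong (total i 0 +_) (+-comm (total (suc i) (suc m)) _)) ⟩
      total i 0 + (total i m + total (suc i) (suc m))
        ≡⟨ cong (total i 0 +_) (local-total i m) ⟩
      total i 0 + (total (suc i) m + total i (suc m) + a i m)
        ≡⟨ regroup₁ (total i 0) (total (suc i) m) (total i (suc m)) (a i m) ⟩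
      total i 0 + total (suc i) m + (total i (suc m) + a i m)
        ≡⟨ cong (_+ (total i (suc m) + a i m)) (partial m) ⟩
      total (suc i) 0 + total i m + ∑ m (a i) + (total i (suc m) + a i m)
        ≡⟨ regroup₂ (total (suc i) 0) (total i m) (∑ m (a i)) (total i (suc m)) (a i m) ⟩
      total (suc i) 0 + total i (suc m) + (∑ m (a i) + a i m) + total i m
        ≡⟨ cong (λ x → total (suc i) 0 + total i (suc m) + x + total i m) (∑-last m (a i)) ⟨
      total (suc i) 0 + total i (suc m) + ∑ (suc m) (a i) + total i m ∎)
      where
      regroup₁ : ∀ x y z w → x + (y + z + w) ≡ x + y + (z + w)
      regroup₁ = solve-∀
      regroup₂ : ∀ x y z w t → x + y + z + (w + t) ≡ x + w + (z + t) + y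
      regroup₂ = solve-∀

  growth-trace : total 0 0 ≡ ∑∑ (bound G) a
  growth-trace = ∑-telescope n (λ i → total i 0) (λ i → ∑ n (a i)) total-row
    (∑-zero n (empty G n 0 (inj₁ ≤-refl)))
    where n = bound G

  -- By `total-row`, the size at (i, 0) is the sum of the matrix from row i on, so summation by
  -- parts counts row i of the matrix i times.
  growth-column : ∑ (bound G) (λ i → total (suc i) 0) ≡ ∑ (bound G) (λ i → i * ∑ (bound G) (a i))
  growth-column = ∑-by-parts n (λ i → total i 0) (λ i → ∑ n (a i)) total-row
    (∑-zero n (empty G n 0 (inj₁ ≤-refl)))
    where n = bound G

-- Trace and volume

-- The array with main diagonal L 0 0 and the L i 0 and L 0 j as the diagonals
-- below and above it; in every value used one of the two indices of L is 0.

assemble : (ℕ → ℕ → Sequence) → Matrix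
assemble L x y = L (x ∸ y) (y ∸ x) (x ⊓ y)

-- A step down from the main diagonal or below it leads to the next diagonal at the same part, and
-- above it to the previous diagonal at the next part: the two halves of interlacing. Away from row
-- 0 and column 0, first parts are dropped and the argument repeats.
assemble-down : ∀ L → (∀ i → L (suc i) 0 ≺ L i 0) → (∀ j → L 0 (suc j) ≺ L 0 j) →
                ∀ x y → assemble L (suc x) y ≤ assemble L x y
assemble-down L down right zero    zero    = proj₁ (down 0) 0
assemble-down L down right (suc x) zero    = proj₁ (down (suc x)) 0
assemble-down L down right zero    (suc zero)    = proj₂ (right 0) 0
assemble-down L down right zero    (suc (suc y)) = proj₂ (right (suc y)) 0
assemble-down L down right (suc x) (suc y) =
  assemble-down (λ i j → L i j ∘ suc)
    (λ i → proj₁ (down i) ∘ suc , proj₂ (down i) ∘ suc)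
    (λ j → proj₁ (right j) ∘ suc , proj₂ (right j) ∘ suc) x y

assemble-flip : ∀ L x y → assemble (flip L) y x ≡ assemble L x y
assemble-flip L x y = cong (L (x ∸ y) (y ∸ x)) (⊓-comm y x)

assemble-below : ∀ L i r → assemble L (r + i) r ≡ L i 0 r
assemble-below L zero    zero    = refl
assemble-below L (suc i) zero    = refl
assemble-below L i (suc r) = assemble-below (λ i j → L i j ∘ suc) i r

assemble-beside : ∀ L j r → assemble L r (r + j) ≡ L 0 j r
assemble-beside L j r = trans (sym (assemble-flip L r (r + j))) (assemble-below (flip L) j r)

assemble-self : ∀ L (f : Matrix) → (∀ i r → L i 0 r ≡ f (r + i) r) → (∀ j r → L 0 j r ≡ f r (r + j)) →
                ∀ x y → assemble L x y ≡ f x y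
assemble-self L f left top zero    zero    = top zero 0
assemble-self L f left top zero    (suc y) = top (suc y) 0
assemble-self L f left top (suc x) zero    = left (suc x) 0
assemble-self L f left top (suc x) (suc y) =
  assemble-self (λ i j → L i j ∘ suc) (λ i j → f (suc i) (suc j)) (λ i → left i ∘ suc) (λ j → top j ∘ suc) x y

module _ {a L} (G : Growth a L) where
  open GrowthProperties G
  open GrowthProperties (transpose G) using () renaming (late-zero to late-zeroʳ; growth-column to growth-row)

  fromGrowth : PlanePartition
  fromGrowth = record
    { entry            = assemble L
    ; down-decreasing  = assemble-down L (λ i → down G i 0) (right G 0)
    ; right-decreasing = λ x y → subst₂ _≤_ (assemble-flip L x (suc y)) (assemble-flip L x y)
                           (assemble-down (flip L) (right G 0) (λ i → down G i 0) y x)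
    ; size             = bound G
    ; vanishing        = λ
      -- The part index `x ⊓ y` and the row `x ∸ y` add up to `x`, which is the quantity that
      -- `late-zero` bounds.
      { x y (inj₁ n≤x) → late-zero (y ∸ x) (≤-trans n≤x (≤-reflexive (sym (m⊓n+m∸n≡m x y))))
      ; x y (inj₂ n≤y) → late-zeroʳ (x ∸ y) (≤-trans n≤y (≤-reflexive (sym (m⊓n+n∸m≡n x y))))
      }
    }
    where
    m⊓n+m∸n≡m : ∀ m n → m ⊓ n + (m ∸ n) ≡ m
    m⊓n+m∸n≡m m n = trans (cong (_+ (m ∸ n)) (⊓-comm m n)) (m⊓n+n∸m≡n n m)

  trace-fromGrowth : trace fromGrowth ≡ ∑∑ (bound G) a
  trace-fromGrowth = begin
    trace fromGrowth                  ≡⟨ sum-map-upTo (λ i → assemble L i i) n ⟩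
    ∑ n (λ r → assemble L r r)        ≡⟨ ∑-cong n (λ r → trans (cong (assemble L r) (sym (+-identityʳ r))) (assemble-beside L 0 r)) ⟩
    total 0 0                         ≡⟨ growth-trace ⟩
    ∑∑ n a                            ∎
    where
    open ≡-Reasoning
    n = bound G

  -- The main diagonal contributes the sum of the a i j, the diagonals below it that of i * a i j,
  -- and those above it that of j * a i j.
  volume-fromGrowth : volume fromGrowth ≡ ∑∑ (bound G) (λ i j → a i j * suc (i + j))
  volume-fromGrowth = begin
    volume fromGrowth
      ≡⟨ sum-map-square (λ (x , y) → assemble L x y) n ⟩
    ∑∑ n (assemble L)
      ≡⟨ ∑∑-diagonals n (assemble L) (vanishing fromGrowth) ⟩
    ∑ n (λ r → assemble L r r + (∑ n (λ d → assemble L (r + suc d) r) + ∑ n (λ d → assemble L r (r + suc d))))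
      ≡⟨ ∑-cong n (λ r → cong₂ _+_
           (trans (cong (assemble L r) (sym (+-identityʳ r))) (assemble-beside L 0 r))
           (cong₂ _+_ (∑-cong n (λ d → assemble-below L (suc d) r)) (∑-cong n (λ d → assemble-beside L (suc d) r)))) ⟩
    ∑ n (λ r → L 0 0 r + (left r + top r))
      ≡⟨ trans (∑-distrib-+ n (L 0 0) (λ r → left r + top r)) (cong (total 0 0 +_) (∑-distrib-+ n left top)) ⟩
    total 0 0 + (∑ n left + ∑ n top)
      ≡⟨ cong₂ (λ x y → total 0 0 + (x + y)) (∑-swap n n (λ r d → L (suc d) 0 r)) (∑-swap n n (λ r d → L 0 (suc d) r)) ⟩
    total 0 0 + (∑ n (λ i → total (suc i) 0) + ∑ n (λ j → total 0 (suc j)))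
      ≡⟨ cong₂ _+_ growth-trace (cong₂ _+_ growth-column growth-row) ⟩
    ∑∑ n a + (∑ n (λ i → i * ∑ n (a i)) + ∑ n (λ j → j * ∑ n (λ i → a i j)))
      ≡⟨ cong (∑∑ n a +_) (cong₂ _+_ (∑-cong n (λ i → ∑-*-distribˡ n i (a i)))
           (trans (∑-cong n (λ j → ∑-*-distribˡ n j (λ i → a i j))) (∑-swap n n (λ j i → j * a i j)))) ⟩
    ∑∑ n a + (∑∑ n (λ i j → i * a i j) + ∑∑ n (λ i j → j * a i j))
      ≡⟨ cong (∑∑ n a +_) (∑∑-distrib-+ (λ i j → i * a i j) (λ i j → j * a i j)) ⟨
    ∑∑ n a + ∑∑ n (λ i j → i * a i j + j * a i j)
      ≡⟨ ∑∑-distrib-+ a (λ i j → i * a i j + j * a i j) ⟨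
    ∑∑ n (λ i j → a i j + (i * a i j + j * a i j))
      ≡⟨ ∑∑-cong n (λ i j → weights (a i j) i j) ⟩
    ∑∑ n (λ i j → a i j * suc (i + j)) ∎
    where
    open ≡-Reasoning
    n = bound G
    left = λ r → ∑ n (λ d → L (suc d) 0 r)
    top = λ r → ∑ n (λ d → L 0 (suc d) r)
    ∑∑-distrib-+ : ∀ (f g : ℕ → ℕ → ℕ) → ∑∑ n (λ i j → f i j + g i j) ≡ ∑∑ n f + ∑∑ n g
    ∑∑-distrib-+ f g = trans (∑-cong n (λ i → ∑-distrib-+ n (f i) (g i)))
      (∑-distrib-+ n (λ i → ∑ n (f i)) (λ i → ∑ n (g i)))
    weights : ∀ x i j → x + (i * x + j * x) ≡ x * suc (i + j)
    weights = solve-∀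

module _ (π : PlanePartition) where
  -- The two sides are the diagonals of `π`, and the interior is filled in by the backward rule.
  diagonals : ℕ → ℕ → Sequence
  diagonals zero    j       r = entry π r (r + j)
  diagonals (suc i) zero    r = entry π (r + suc i) r
  diagonals (suc i) (suc j) r = beneath (diagonals i j) (diagonals (suc i) j) (diagonals i (suc j)) r

  diagonals-zeroʳ : ∀ i r → diagonals i 0 r ≡ entry π (r + i) r
  diagonals-zeroʳ zero    r = cong₂ (entry π) (sym (+-identityʳ r)) (+-identityʳ r)
  diagonals-zeroʳ (suc i) r = refl

  mutual
    -- On the boundary, the two halves of interlacing are the two monotonicity conditions of a plane
    -- partition; in the interior the backward rule preserves interlacing.
    diagonals-down : ∀ i j → diagonals (suc i) j ≺ diagonals i j
    diagonals-down i zero =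
      (λ r → subst₂ _≤_ (cong (λ x → entry π x r) (sym (+-suc r i))) (sym (diagonals-zeroʳ i r))
        (down-decreasing π (r + i) r)) ,
      (λ r → subst₂ _≤_ (sym (diagonals-zeroʳ i (suc r))) (cong (λ x → entry π x r) (sym (+-suc r i)))
        (right-decreasing π (suc r + i) r))
    diagonals-down i (suc j) = proj₂ (beneath-≺ (diagonals-down i j) (diagonals-right i j))

    diagonals-right : ∀ i j → diagonals i (suc j) ≺ diagonals i j
    diagonals-right zero j =
      (λ r → subst (_≤ entry π r (r + j)) (cong (entry π r) (sym (+-suc r j))) (right-decreasing π r (r + j))) ,
      (λ r → subst (entry π (suc r) (suc r + j) ≤_) (cong (entry π r) (sym (+-suc r j))) (down-decreasing π r (suc r + j)))
    diagonals-right (suc i) j = proj₁ (beneath-≺ (diagonals-down i j) (diagonals-right i j))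

  diagonals-emptyˡ : ∀ i j r → size π ≤ i → diagonals i j r ≡ 0
  diagonals-emptyˡ i zero    r n≤i = trans (diagonals-zeroʳ i r) (vanishing π (r + i) r (inj₁ (m≤n⇒m≤o+n r n≤i)))
  diagonals-emptyˡ i (suc j) r n≤i =
    n≤0⇒n≡0 (≤-trans (proj₁ (diagonals-right i j) r) (≤-reflexive (diagonals-emptyˡ i j r n≤i)))

  diagonals-emptyʳ : ∀ i j r → size π ≤ j → diagonals i j r ≡ 0
  diagonals-emptyʳ zero    j r n≤j = vanishing π r (r + j) (inj₂ (m≤n⇒m≤o+n r n≤j))
  diagonals-emptyʳ (suc i) j r n≤j =
    n≤0⇒n≡0 (≤-trans (proj₁ (diagonals-down i j) r) (≤-reflexive (diagonals-emptyʳ i j r n≤j)))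

  -- The entries are forced by `first`; interlacing keeps the subtraction from being truncated.
  excess : Matrix
  excess i j = diagonals i j 0 ∸ (diagonals (suc i) j 0 ⊔ diagonals i (suc j) 0)

  diagonalGrowth : Growth excess diagonals
  diagonalGrowth = record
    { down  = diagonals-down
    ; right = diagonals-right
    ; first = λ i j → sym (m+[n∸m]≡n (⊔-lub (proj₁ (diagonals-down i j) 0) (proj₁ (diagonals-right i j) 0)))
    ; later = λ i j r → trans (+-comm (diagonals i j (suc r)) _)
                          (reflect-+ (suc≤upper (diagonals-down i j) (diagonals-right i j) r))
    ; bound = size π
    ; empty = λ { i j (inj₁ n≤i) r → diagonals-emptyˡ i j r n≤i ; i j (inj₂ n≤j) r → diagonals-emptyʳ i j r n≤j }
    }

  excess-vanishing : Vanishing (size π) excess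
  excess-vanishing i j out = n≤0⇒n≡0 (≤-trans
    (m∸n≤m (diagonals i j 0) (diagonals (suc i) j 0 ⊔ diagonals i (suc j) 0))
    (≤-reflexive (empty diagonalGrowth i j out 0)))

  assemble-diagonals : ∀ x y → assemble diagonals x y ≡ entry π x y
  assemble-diagonals = assemble-self diagonals (entry π) diagonals-zeroʳ (λ j r → refl)

-- Descents and up-hook volume

≤-from-< : ∀ {m n} → (∀ k → k < m → k < n) → m ≤ n
≤-from-< {zero}  f = z≤n
≤-from-< {suc m} f = f m (n<1+n m)

-- Conjugation is described by which numbers lie below an entry, so entries are compared in these
-- terms.
≡-from-< : ∀ {m n} → (∀ k → k < m → k < n) → (∀ k → k < n → k < m) → m ≡ n
≡-from-< f g = ≤-antisym (≤-from-< f) (≤-from-< g)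

decreasing-≤ : ∀ {f : ℕ → ℕ} → (∀ i → f (suc i) ≤ f i) → ∀ i → f i ≤ f 0
decreasing-≤ dec zero    = ≤-refl
decreasing-≤ dec (suc i) = ≤-trans (dec i) (decreasing-≤ dec i)

count : ℕ → (ℕ → ℕ) → ℕ → ℕ
count n f l = ∑ n (λ j → χ (l <? f j))

-- The parts of a partition that exceed l form an initial segment.

<-count : ∀ n (f : ℕ → ℕ) → (∀ j → f (suc j) ≤ f j) → (∀ j → n ≤ j → f j ≡ 0) →
  ∀ j l → (j < count n f l → l < f j) × (l < f j → j < count n f l)
<-count zero f dec f≡0 j l = (λ ()) , λ l<fj → contradiction (subst (l <_) (f≡0 j z≤n) l<fj) λ ()
<-count (suc n) f dec f≡0 j l with l <? f 0
<-count (suc n) f dec f≡0 zero    l | yes l<f0 = (λ _ → l<f0) , (λ _ → z<s)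
<-count (suc n) f dec f≡0 (suc j) l | yes l<f0 = proj₁ ih ∘ s<s⁻¹ , s<s ∘ proj₂ ih
  where ih = <-count n (f ∘ suc) (dec ∘ suc) (λ j → f≡0 (suc j) ∘ s≤s) j l
<-count (suc n) f dec f≡0 j       l | no  l≮f0 =
  (λ j< → contradiction (<-≤-trans (proj₁ ih j<) (decreasing-≤ dec (suc j))) l≮f0) ,
  (λ l< → contradiction (<-≤-trans l< (decreasing-≤ dec j)) l≮f0)
  where ih = <-count n (f ∘ suc) (dec ∘ suc) (λ j → f≡0 (suc j) ∘ s≤s) j l

module _ (π : PlanePartition) where
  private
    conjugateEntry : ℕ → ℕ → ℕ
    conjugateEntry i = count (size π) (entry π i)

    -- The defining relation of row conjugation, symmetric under exchanging `j` with `l` and the row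
    -- with its conjugate. Monotonicity and involutivity follow from it.
    row : ∀ i j l → (j < conjugateEntry i l → l < entry π i j) × (l < entry π i j → j < conjugateEntry i l)
    row i = <-count (size π) (entry π i) (right-decreasing π i) (λ j → vanishing π i j ∘ inj₂)

  conjugate : PlanePartition
  conjugate = record
    { entry            = conjugateEntry
    ; down-decreasing  = λ i l → ≤-from-< (λ j j< → proj₂ (row i j l) (<-≤-trans (proj₁ (row (suc i) j l) j<) (down-decreasing π i j)))
    ; right-decreasing = λ i l → ≤-from-< (λ j j< → proj₂ (row i j l) (<-trans (n<1+n l) (proj₁ (row i j (suc l)) j<)))
    -- Columns of the conjugate are indexed by values of entries, and `entry π 0 0` bounds them all.
    ; size             = size π ⊔ entry π 0 0
    ; vanishing        = λ
      { i l (inj₁ n≤i) → n≤0⇒n≡0 (≤-from-< (λ j j< → contradiction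
          (subst (l <_) (vanishing π i j (inj₁ (≤-trans (m≤m⊔n _ _) n≤i))) (proj₁ (row i j l) j<)) λ ()))
      ; i l (inj₂ n≤l) → n≤0⇒n≡0 (≤-from-< (λ j j< → contradiction
          (<-≤-trans (proj₁ (row i j l) j<) (≤-trans (≤-trans (decreasing-≤ (right-decreasing π i) j)
            (decreasing-≤ (λ i → down-decreasing π i 0) i)) (≤-trans (m≤n⊔m (size π) _) n≤l))) (<-irrefl refl)))
      }
    }

  <-conjugate : ∀ i j l → j < entry conjugate i l → l < entry π i j
  <-conjugate i j l = proj₁ (row i j l)

  conjugate-< : ∀ i j l → l < entry π i j → j < entry conjugate i l
  conjugate-< i j l = proj₂ (row i j l)

  size≤size-conjugate : size π ≤ size conjugate
  size≤size-conjugate = m≤m⊔n (size π) (entry π 0 0)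

_≈ᵖ_ : PlanePartition → PlanePartition → Set
π ≈ᵖ ρ = ∀ i j → entry π i j ≡ entry ρ i j

conjugate-cong : ∀ π ρ → π ≈ᵖ ρ → conjugate π ≈ᵖ conjugate ρ
conjugate-cong π ρ π≈ρ i l = ≡-from-<
  (λ j j< → conjugate-< ρ i j l (subst (l <_) (π≈ρ i j) (<-conjugate π i j l j<)))
  (λ j j< → conjugate-< π i j l (subst (l <_) (sym (π≈ρ i j)) (<-conjugate ρ i j l j<)))

conjugate-involutive : ∀ π → conjugate (conjugate π) ≈ᵖ π
conjugate-involutive π i j = ≡-from-<
  (λ l l< → <-conjugate π i j l (<-conjugate (conjugate π) i l j l<))
  (λ l l< → conjugate-< (conjugate π) i l j (conjugate-< π i j l l<))

-- With `g` constantly 1 this gives `des`, and with `g i x` equal to `x + i` the up-hook volume, so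
-- both statistics are computed at once.
weightedDescents : (ℕ → ℕ → ℕ) → PlanePartition → Matrix
weightedDescents g π i j = χ (entry π (suc i) j <? entry π i j) * g i (entry π i j)

χ-no : ∀ {P : Set} (P? : Dec P) → ¬ P → χ P? ≡ 0
χ-no (yes p) ¬p = contradiction p ¬p
χ-no (no _)  ¬p = refl

χ-yes : ∀ {P : Set} (P? : Dec P) → P → χ P? ≡ 1
χ-yes (yes _) p = refl
χ-yes (no ¬p) p = contradiction p ¬p

weightedDescents-vanishing : ∀ g π → Vanishing (size π) (weightedDescents g π)
weightedDescents-vanishing g π i j out =
  cong (_* g i (entry π i j)) (χ-no (entry π (suc i) j <? entry π i j)
    (λ descent → contradiction (subst (entry π (suc i) j <_) (vanishing π i j out) descent) λ ()))

des-∑∑ : ∀ π → des π ≡ ∑∑ (size π) (weightedDescents (λ _ _ → 1) π)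
des-∑∑ π = begin
  des π
    ≡⟨ length≡sum (Des π) ⟩
  ListAction.sum (map (λ _ → 1) (Des π))
    ≡⟨ sum-map-filter (λ (i , j) → entry π (suc i) j <? entry π i j) (λ _ → 1) (square π) ⟩
  ListAction.sum (map (λ (i , j) → weightedDescents (λ _ _ → 1) π i j) (square π))
    ≡⟨ sum-map-square _ (size π) ⟩
  ∑∑ (size π) (weightedDescents (λ _ _ → 1) π) ∎
  where open ≡-Reasoning

upHookVolume-∑∑ : ∀ π → upHookVolume π ≡ ∑∑ (size π) (weightedDescents (λ i x → x + i) π)
upHookVolume-∑∑ π = begin
  upHookVolume π
    ≡⟨ sum-map-filter (λ (i , j) → entry π (suc i) j <? entry π i j) (λ (i , j) → entry π i j + i) (square π) ⟩
  ListAction.sum (map (λ (i , j) → weightedDescents (λ i x → x + i) π i j) (square π))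
    ≡⟨ sum-map-square _ (size π) ⟩
  ∑∑ (size π) (weightedDescents (λ i x → x + i) π) ∎
  where open ≡-Reasoning

-- Equal plane partitions may carry different sizes; both sums are extended to a common square.
∑∑-cong-vanishing : ∀ {m n} {f g : ℕ → ℕ → ℕ} → (∀ i j → f i j ≡ g i j) →
                    Vanishing m f → Vanishing n g → ∑∑ m f ≡ ∑∑ n g
∑∑-cong-vanishing {m} {n} {f} {g} f≡g f≡0 g≡0 = begin
  ∑∑ m f       ≡⟨ ∑∑-extend f (m≤m⊔n m n) f≡0 ⟨
  ∑∑ (m ⊔ n) f ≡⟨ ∑∑-cong (m ⊔ n) f≡g ⟩
  ∑∑ (m ⊔ n) g ≡⟨ ∑∑-extend g (m≤n⊔m m n) g≡0 ⟩
  ∑∑ n g       ∎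
  where open ≡-Reasoning

upHookVolume-cong : ∀ π ρ → π ≈ᵖ ρ → upHookVolume π ≡ upHookVolume ρ
upHookVolume-cong π ρ π≈ρ = begin
  upHookVolume π ≡⟨ upHookVolume-∑∑ π ⟩
  ∑∑ (size π) (weightedDescents g π)
    ≡⟨ ∑∑-cong-vanishing
         (λ i j → cong₂ (λ x y → χ (x <? y) * g i y) (π≈ρ (suc i) j) (π≈ρ i j))
         (weightedDescents-vanishing g π) (weightedDescents-vanishing g ρ) ⟩
  ∑∑ (size ρ) (weightedDescents g ρ) ≡⟨ upHookVolume-∑∑ ρ ⟨
  upHookVolume ρ ∎
  where
  open ≡-Reasoning
  g = λ i x → x + i

volume-cong : ∀ π ρ → π ≈ᵖ ρ → volume π ≡ volume ρ
volume-cong π ρ π≈ρ = begin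
  volume π              ≡⟨ sum-map-square (λ (i , j) → entry π i j) (size π) ⟩
  ∑∑ (size π) (entry π) ≡⟨ ∑∑-cong-vanishing π≈ρ (vanishing π) (vanishing ρ) ⟩
  ∑∑ (size ρ) (entry ρ) ≡⟨ sum-map-square (λ (i , j) → entry ρ i j) (size ρ) ⟨
  volume ρ              ∎
  where open ≡-Reasoning

∑-χ-< : ∀ {n m} → m ≤ n → ∑ n (λ j → χ (j <? m)) ≡ m
∑-χ-< {n}     {zero}  z≤n       = ∑-zero n (λ j → χ-no (j <? 0) λ ())
∑-χ-< {suc n} {suc m} (s≤s m≤n) = cong₂ _+_ (χ-yes (0 <? suc m) z<s)
  (trans (∑-cong n (λ j → χ-cong (suc j <? suc m) (j <? m) s<s⁻¹ s<s)) (∑-χ-< m≤n))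

descent-expansion : ∀ {n} (g : ℕ → ℕ) p p′ → p ≤ n →
  χ (p′ <? p) * g p ≡ ∑ n (λ l → δ p (suc l) * (χ (p′ <? suc l) * g (suc l)))
descent-expansion {n} g zero    p′ p≤n =
  trans (cong (_* g 0) (χ-no (p′ <? 0) λ ())) (sym (∑-zero n (λ _ → refl)))
descent-expansion g (suc k) p′ p≤n = sym (∑-δ (λ l → χ (p′ <? suc l) * g (suc l)) p≤n)

-- For p′ ≤ p, the numbers l < p that do not satisfy l < p′ or l + 1 < p are
-- those with p = l + 1 and p′ ≤ l.

descent-indicator : ∀ {Q : Set} (Q? : Dec Q) {p p′} l → p′ ≤ p →
  (Q → l < p′ ⊎ suc l < p) → (l < p′ ⊎ suc l < p → Q) →
  χ Q? + δ p (suc l) * χ (p′ <? suc l) ≡ χ (l <? p)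
descent-indicator Q? {p} {p′} l p′≤p to from with <-cmp p (suc l)
... | tri< p<1+l p≢1+l _ = begin
  χ Q? + δ p (suc l) * χ (p′ <? suc l)
    ≡⟨ cong₂ (λ x y → x + y * χ (p′ <? suc l))
         (χ-no Q? (λ q → [ (λ l<p′ → <⇒≱ l<p′ (≤-trans p′≤p (s≤s⁻¹ p<1+l))) , <-asym p<1+l ]′ (to q)))
         (δ-≢ p≢1+l) ⟩
  0 ≡⟨ χ-no (l <? p) (≤⇒≯ (s≤s⁻¹ p<1+l)) ⟨
  χ (l <? p) ∎
  where open ≡-Reasoning
... | tri> _ p≢1+l 1+l<p = begin
  χ Q? + δ p (suc l) * χ (p′ <? suc l)
    ≡⟨ cong₂ (λ x y → x + y * χ (p′ <? suc l)) (χ-yes Q? (from (inj₂ 1+l<p))) (δ-≢ p≢1+l) ⟩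
  1 ≡⟨ χ-yes (l <? p) (<-trans (n<1+n l) 1+l<p) ⟨
  χ (l <? p) ∎
  where open ≡-Reasoning
... | tri≈ _ refl _ with l <? p′
...   | yes l<p′ = begin
  χ Q? + δ l l * χ (p′ <? suc l)
    ≡⟨ cong₂ (λ x y → x + δ l l * y) (χ-yes Q? (from (inj₁ l<p′))) (χ-no (p′ <? suc l) (≤⇒≯ l<p′)) ⟩
  1 + δ l l * 0 ≡⟨ cong suc (*-zeroʳ (δ l l)) ⟩
  1 ≡⟨ χ-yes (l <? suc l) (n<1+n l) ⟨
  χ (l <? suc l) ∎
  where open ≡-Reasoning
...   | no  l≮p′ = begin
  χ Q? + δ l l * χ (p′ <? suc l)
    ≡⟨ cong₂ _+_ (χ-no Q? (λ q → [ l≮p′ , <-irrefl refl ]′ (to q))) (cong₂ _*_ (δ-refl l) (χ-yes (p′ <? suc l) (s≤s (≮⇒≥ l≮p′)))) ⟩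
  1 ≡⟨ χ-yes (l <? suc l) (n<1+n l) ⟨
  χ (l <? suc l) ∎
  where open ≡-Reasoning

module _ {a L} (G : Growth a L) where
  open GrowthProperties G using (matrix-vanishing)

  firstParts : PlanePartition
  firstParts = record
    { entry            = λ i l → L i l 0
    ; down-decreasing  = λ i l → proj₁ (down G i l) 0
    ; right-decreasing = λ i l → proj₁ (right G i l) 0
    ; size             = bound G
    ; vanishing        = λ i l out → empty G i l out 0
    }

  private
    π = conjugate firstParts
    n = size π

  -- Ensures that the levels l < n in `descent-expansion` cover every entry.
  entry≤n : ∀ i j → entry π i j ≤ n
  entry≤n i j = ≤-from-< (λ l l< → ≰⇒> (λ n≤l →
    contradiction (subst (j <_) (empty G i l (inj₂ (≤-trans (size≤size-conjugate firstParts) n≤l)) 0)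
      (<-conjugate firstParts i l j l<)) λ ()))

  -- Row `i` of the conjugate has `L i l 0` entries above l. Of these positions, `m` are the ones
  -- where the entry exceeds l + 1 or the entry below exceeds l; the remaining ones are the descents
  -- at l + 1, and by `first` there are `a i l` of them.
  descents-at-level : ∀ i l → ∑ n (λ j → δ (entry π i j) (suc l) * χ (entry π (suc i) j <? suc l)) ≡ a i l
  descents-at-level i l = +-cancelˡ-≡ m _ _ (begin
    m + ∑ n D
      ≡⟨ cong (_+ ∑ n D) (∑-χ-< (≤-trans (m≤m+n m (a i l)) (≤-trans (≤-reflexive (sym (first G i l))) L≤n))) ⟨
    ∑ n (λ j → χ (j <? m)) + ∑ n D
      ≡⟨ ∑-distrib-+ n (λ j → χ (j <? m)) D ⟨
    ∑ n (λ j → χ (j <? m) + D j)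
      ≡⟨ ∑-cong n (λ j → descent-indicator (j <? m) l (down-decreasing π i j) (to j) (from j)) ⟩
    ∑ n (λ j → χ (l <? entry π i j))
      ≡⟨ ∑-cong n (λ j → χ-cong (l <? entry π i j) (j <? L i l 0)
           (<-conjugate firstParts i l j) (conjugate-< firstParts i l j)) ⟩
    ∑ n (λ j → χ (j <? L i l 0))
      ≡⟨ ∑-χ-< L≤n ⟩
    L i l 0
      ≡⟨ first G i l ⟩
    m + a i l ∎)
    where
    open ≡-Reasoning
    m = L (suc i) l 0 ⊔ L i (suc l) 0
    D = λ j → δ (entry π i j) (suc l) * χ (entry π (suc i) j <? suc l)
    L≤n : L i l 0 ≤ n
    L≤n = ≤-trans (≤-trans (decreasing-≤ (right-decreasing firstParts i) l)
      (decreasing-≤ (λ i → down-decreasing firstParts i 0) i)) (m≤n⊔m (bound G) _)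
    to : ∀ j → j < m → l < entry π (suc i) j ⊎ suc l < entry π i j
    -- The maximum is one of its two arguments, which decides the alternative.
    to j j<m with ⊔-sel (L (suc i) l 0) (L i (suc l) 0)
    ... | inj₁ m≡ = inj₁ (conjugate-< firstParts (suc i) l j (subst (j <_) m≡ j<m))
    ... | inj₂ m≡ = inj₂ (conjugate-< firstParts i (suc l) j (subst (j <_) m≡ j<m))
    from : ∀ j → l < entry π (suc i) j ⊎ suc l < entry π i j → j < m
    from j (inj₁ l<) = <-≤-trans (<-conjugate firstParts (suc i) l j l<) (m≤m⊔n (L (suc i) l 0) (L i (suc l) 0))
    from j (inj₂ l<) = <-≤-trans (<-conjugate firstParts i (suc l) j l<) (m≤n⊔m (L (suc i) l 0) (L i (suc l) 0))

  -- The weight depends only on the row and the level, so after exchanging the sums over columns and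
  -- levels it factors out of the count of descents.
  ∑∑-weightedDescents : ∀ g → ∑∑ n (weightedDescents g π) ≡ ∑∑ (bound G) (λ i l → a i l * g i (suc l))
  ∑∑-weightedDescents g = begin
    ∑∑ n (weightedDescents g π)
      ≡⟨ ∑∑-cong n (λ i j → descent-expansion (g i) (entry π i j) (entry π (suc i) j) (entry≤n i j)) ⟩
    ∑∑ n (λ i j → ∑ n (λ l → D i j l * (E i j l * g i (suc l))))
      ≡⟨ ∑-cong n (λ i → ∑-swap n n (λ j l → D i j l * (E i j l * g i (suc l)))) ⟩
    ∑∑ n (λ i l → ∑ n (λ j → D i j l * (E i j l * g i (suc l))))
      ≡⟨ ∑∑-cong n (λ i l → ∑-cong n (λ j → *-assoc (D i j l) (E i j l) (g i (suc l)))) ⟨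
    ∑∑ n (λ i l → ∑ n (λ j → D i j l * E i j l * g i (suc l)))
      ≡⟨ ∑∑-cong n (λ i l → ∑-*-distribʳ n (g i (suc l)) (λ j → D i j l * E i j l)) ⟨
    ∑∑ n (λ i l → ∑ n (λ j → D i j l * E i j l) * g i (suc l))
      ≡⟨ ∑∑-cong n (λ i l → cong (_* g i (suc l)) (descents-at-level i l)) ⟩
    ∑∑ n (λ i l → a i l * g i (suc l))
      ≡⟨ ∑∑-extend (λ i l → a i l * g i (suc l)) (size≤size-conjugate firstParts)
           (λ i l out → cong (_* g i (suc l)) (matrix-vanishing i l out)) ⟩
    ∑∑ (bound G) (λ i l → a i l * g i (suc l)) ∎
    where
    open ≡-Reasoning
    D = λ i j l → δ (entry π i j) (suc l)
    E = λ i j l → χ (entry π (suc i) j <? suc l)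

  des-conjugate-firstParts : des π ≡ ∑∑ (bound G) a
  des-conjugate-firstParts = trans (des-∑∑ π) (trans (∑∑-weightedDescents (λ _ _ → 1))
    (∑∑-cong (bound G) (λ i l → *-identityʳ (a i l))))

  upHookVolume-conjugate-firstParts : upHookVolume π ≡ ∑∑ (bound G) (λ i l → a i l * suc (i + l))
  upHookVolume-conjugate-firstParts = trans (upHookVolume-∑∑ π) (trans (∑∑-weightedDescents (λ i x → x + i))
    (∑∑-cong (bound G) (λ i l → cong (λ x → a i l * suc x) (+-comm l i))))

module _ (π : PlanePartition) where
  private c = entry π

  increments : Matrix
  increments i l = c i l ∸ (c (suc i) l ⊔ c i (suc l))

  increments-+ : ∀ i l → c i l ≡ (c (suc i) l ⊔ c i (suc l)) + increments i l
  increments-+ i l = sym (m+[n∸m]≡n (⊔-lub (down-decreasing π i l) (right-decreasing π i l)))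

  increments-vanishing : Vanishing (size π) increments
  increments-vanishing i l out = n≤0⇒n≡0 (≤-trans (m∸n≤m (c i l) (c (suc i) l ⊔ c i (suc l)))
                                                  (≤-reflexive (vanishing π i l out)))

  -- The first parts and the given array obey the same last passage recursion and vanish far out, so
  -- they agree.
  firstParts-increments : ∀ {a L} (G : Growth a L) → (∀ i l → a i l ≡ increments i l) → firstParts G ≈ᵖ π
  firstParts-increments {a} {L} G a≡ = descend (λ i l → L i l 0 ≡ c i l) (bound G ⊔ size π)
    (λ i l out → trans
      (empty G i l (Sum.map (≤-trans (m≤m⊔n _ _)) (≤-trans (m≤m⊔n _ _)) out) 0)
      (sym (vanishing π i l (Sum.map (≤-trans (m≤n⊔m (bound G) _)) (≤-trans (m≤n⊔m (bound G) _)) out))))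
    (λ i l below beside _ → begin
      L i l 0                                  ≡⟨ first G i l ⟩
      (L (suc i) l 0 ⊔ L i (suc l) 0) + a i l  ≡⟨ cong₂ _+_ (cong₂ _⊔_ below beside) (a≡ i l) ⟩
      (c (suc i) l ⊔ c i (suc l)) + increments i l ≡⟨ increments-+ i l ⟨
      c i l                                    ∎)
    where open ≡-Reasoning

-- Enumeration of matrices

module _ {op : A → A} {v : ℕ} {e : ℕ → List A} (P : ℕ → Pred A 0ℓ)
         (P-op : ∀ {n x} → P n x → P (v + suc n) (op x)) (P-e : ∀ n → All (P n) (e n)) where
  mutual
    All-adjoin : ∀ n → All (P n) (adjoin op v e n)
    All-adjoin n = Allₚ.++⁺ (P-e n) (All-raised 0 v n refl)

    -- `w` records how far `u` has come down from `v`; `w + n` stays constant until the operation is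
    -- applied at `w = v`.
    All-raised : ∀ w u n → w + u ≡ v → All (P (w + n)) (raised op v e u n)
    All-raised w u       zero    w+u≡v = []
    All-raised w zero    (suc n) w+0≡v = subst (λ w → All (P (w + suc n)) (map op (adjoin op v e n)))
      (trans (sym w+0≡v) (+-identityʳ w)) (Allₚ.map⁺ (All.map P-op (All-adjoin n)))
    All-raised w (suc u) (suc n) w+u≡v = subst (λ m → All (P m) (raised op v e u n))
      (sym (+-suc w n)) (All-raised (suc w) u n (trans (sym (+-suc w u)) w+u≡v))

raised-large : ∀ (op : A → A) v e u n → raised op v e u (suc (u + n)) ≡ map op (adjoin op v e n)
raised-large op v e zero    n = refl
raised-large op v e (suc u) n = raised-large op v e u n

Cell : Set
Cell = ℕ × ℕ

level : Cell → ℕ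
level (k , l) = k + l

elementary : Cell → Matrix
elementary (k , l) i j = δ k i * δ l j

elementary-self : ∀ c → elementary c (proj₁ c) (proj₂ c) ≡ 1
elementary-self (k , l) = cong₂ _*_ (δ-refl k) (δ-refl l)

elementary-other : ∀ c i j → c ≢ (i , j) → elementary c i j ≡ 0
elementary-other (k , l) i j c≢ij with k ≟ i
... | no  k≢i  = cong (_* δ l j) (δ-≢ k≢i)
... | yes refl = trans (cong (δ k k *_) (δ-≢ (c≢ij ∘ cong (k ,_)))) (*-zeroʳ (δ k k))

_≟ᶜ_ : (c d : Cell) → Dec (c ≡ d)
_≟ᶜ_ = ≡-dec _≟_ _≟_

increment decrement : Cell → Matrix → Matrix
increment c a i j = elementary c i j + a i j
decrement c a i j = a i j ∸ elementary c i j

zeroMatrix : Matrix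
zeroMatrix i j = 0

-- The same fold as `sizes`, on matrices instead of their sizes: one unit in a cell adds
-- `level c + 1` to the weight.
enumerate : List Cell → ℕ → List Matrix
enumerate = foldr (λ c → adjoin (increment c) (level c)) (unit zeroMatrix)

Supported : List Cell → Matrix → Set
Supported cs a = ∀ i j → (i , j) ∉ cs → a i j ≡ 0

weight : ℕ → Matrix → ℕ
weight n a = ∑∑ n (λ i j → a i j * suc (i + j))

module _ (n : ℕ) where
  Within : Cell → Set
  Within (k , l) = k < n × l < n

  -- Matrices are compared only on the square, the part of them that a growth of side `n` depends
  -- on.
  squareSetoid : Setoid 0ℓ 0ℓ
  squareSetoid = record
    { Carrier       = Matrix
    ; _≈_           = λ a b → ∀ i j → i < n → j < n → a i j ≡ b i j
    ; isEquivalence = record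
      { refl  = λ i j _ _ → refl
      ; sym   = λ p i j i<n j<n → sym (p i j i<n j<n)
      ; trans = λ p q i j i<n j<n → trans (p i j i<n j<n) (q i j i<n j<n)
      }
    }

  open Setoid squareSetoid using (_≈_)
  open SetoidMembership squareSetoid using () renaming (_∈_ to _∈ₙ_)
  open SetoidUnique squareSetoid using () renaming (Unique to Uniqueₙ)

  ∑∑-increment : ∀ c → Within c → ∀ a (g : Matrix) →
    ∑∑ n (λ i j → increment c a i j * g i j) ≡ g (proj₁ c) (proj₂ c) + ∑∑ n (λ i j → a i j * g i j)
  ∑∑-increment (k , l) (k<n , l<n) a g = begin
    ∑∑ n (λ i j → (δ k i * δ l j + a i j) * g i j)
      ≡⟨ ∑-cong n (λ i → trans (∑-cong n (λ j → *-distribʳ-+ (g i j) (δ k i * δ l j) (a i j)))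
                               (∑-distrib-+ n (λ j → δ k i * δ l j * g i j) (λ j → a i j * g i j))) ⟩
    ∑ n (λ i → ∑ n (λ j → δ k i * δ l j * g i j) + ∑ n (λ j → a i j * g i j))
      ≡⟨ ∑-distrib-+ n (λ i → ∑ n (λ j → δ k i * δ l j * g i j)) (λ i → ∑ n (λ j → a i j * g i j)) ⟩
    ∑∑ n (λ i j → δ k i * δ l j * g i j) + rest
      ≡⟨ cong (_+ rest) (∑-cong n (λ i → trans (∑-cong n (λ j → *-assoc (δ k i) (δ l j) (g i j)))
                                               (sym (∑-*-distribˡ n (δ k i) (λ j → δ l j * g i j))))) ⟩
    ∑ n (λ i → δ k i * ∑ n (λ j → δ l j * g i j)) + rest
      ≡⟨ cong (_+ rest) (∑-δ (λ i → ∑ n (λ j → δ l j * g i j)) k<n) ⟩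
    ∑ n (λ j → δ l j * g k j) + rest
      ≡⟨ cong (_+ rest) (∑-δ (g k) l<n) ⟩
    g k l + rest ∎
    where
    open ≡-Reasoning
    rest = ∑∑ n (λ i j → a i j * g i j)

  ∑∑-increment-1 : ∀ c → Within c → ∀ a → ∑∑ n (increment c a) ≡ suc (∑∑ n a)
  ∑∑-increment-1 c c<n a = begin
    ∑∑ n (increment c a)                   ≡⟨ ∑∑-cong n (λ i j → *-identityʳ (increment c a i j)) ⟨
    ∑∑ n (λ i j → increment c a i j * 1)   ≡⟨ ∑∑-increment c c<n a (λ _ _ → 1) ⟩
    suc (∑∑ n (λ i j → a i j * 1))         ≡⟨ cong suc (∑∑-cong n (λ i j → *-identityʳ (a i j))) ⟩
    suc (∑∑ n a)                           ∎
    where open ≡-Reasoning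

  weight-increment : ∀ c → Within c → ∀ a → weight n (increment c a) ≡ suc (level c + weight n a)
  weight-increment c c<n a = ∑∑-increment c c<n a (λ i j → suc (i + j))

  ∑∑-zeroMatrix : ∀ (g : ℕ → ℕ → ℕ) → ∑∑ n (λ i j → zeroMatrix i j * g i j) ≡ 0
  ∑∑-zeroMatrix g = ∑-zero n (λ i → ∑-zero n (λ j → refl))

  sizes-enumerate : ∀ {cs} → All Within cs → ∀ m → map (∑∑ n) (enumerate cs m) ≡ sizes (map level cs) m
  sizes-enumerate {[]}     []           zero    = cong (_∷ []) (∑-zero n (λ i → ∑-zero n (λ j → refl)))
  sizes-enumerate {[]}     []           (suc m) = refl
  sizes-enumerate {c ∷ cs} (c<n ∷ cs<n) m       =
    map-adjoin (∑∑ n) (∑∑-increment-1 c c<n) (level c) (sizes-enumerate cs<n) m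

  enumerate-weight : ∀ {cs} → All Within cs → ∀ m → All (λ a → weight n a ≡ m) (enumerate cs m)
  enumerate-weight {[]}     []           zero    = ∑∑-zeroMatrix (λ i j → suc (i + j)) ∷ []
  enumerate-weight {[]}     []           (suc m) = []
  enumerate-weight {c ∷ cs} (c<n ∷ cs<n) =
    All-adjoin (λ m a → weight n a ≡ m)
      (λ {m} {a} w → trans (weight-increment c c<n a) (trans (cong (λ x → suc (level c + x)) w) (sym (+-suc (level c) m))))
      (enumerate-weight cs<n)

  enumerate-supported : ∀ cs m → All (Supported cs) (enumerate cs m)
  enumerate-supported []       zero    = (λ i j _ → refl) ∷ []
  enumerate-supported []       (suc m) = []
  enumerate-supported (c ∷ cs) =
    All-adjoin (λ _ → Supported (c ∷ cs))
      (λ s i j ij∉ → cong₂ _+_ (elementary-other c i j (λ { refl → ij∉ (here refl) })) (s i j ij∉))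
      (λ m → All.map (λ s i j ij∉ → s i j (ij∉ ∘ there)) (enumerate-supported cs m))

  -- The head cell separates the two halves of `adjoin`: matrices supported on the other cells
  -- vanish there, incremented ones do not. Within the second half, incrementing is injective.
  enumerate-unique : ∀ {cs} → All Within cs → Unique cs → ∀ m → Uniqueₙ (enumerate cs m)
  enumerate-unique {[]}     []           []           zero    = [] ∷ []
  enumerate-unique {[]}     []           []           (suc m) = []
  enumerate-unique {c@(k , l) ∷ cs} (c<n@(k<n , l<n) ∷ cs<n) (c∉cs ∷ cs!) = unique-adjoin
    where
    e = enumerate cs
    op = increment c
    mutual
      unique-adjoin : ∀ m → Uniqueₙ (adjoin op (level c) e m)
      unique-adjoin m = AllPairsₚ.++⁺ (enumerate-unique cs<n cs! m) (unique-raised (level c) m)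
        (All.map (λ {a} a-supp → All.map (λ {b} b≢0 a≈b → b≢0 (trans (sym (a≈b k l k<n l<n)) (a-supp k l (Allₚ.All¬⇒¬Any c∉cs))))
                   (positive-raised (level c) m))
          (enumerate-supported cs m))

      unique-raised : ∀ u m → Uniqueₙ (raised op (level c) e u m)
      unique-raised u       zero    = []
      unique-raised zero    (suc m) = SetoidUniqueₚ.map⁺ squareSetoid squareSetoid {f = op}
        (λ {a} {b} p i j i<n j<n → +-cancelˡ-≡ (elementary c i j) (a i j) (b i j) (p i j i<n j<n)) (unique-adjoin m)
      unique-raised (suc u) (suc m) = unique-raised u m

      positive-raised : ∀ u m → All (λ b → b k l ≢ 0) (raised op (level c) e u m)
      positive-raised u       zero    = []
      positive-raised zero    (suc m) = Allₚ.map⁺ (All.universal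
        (λ a b≡0 → contradiction (trans (cong (_+ a k l) (sym (elementary-self c))) b≡0) λ ()) (adjoin op (level c) e m))
      positive-raised (suc u) (suc m) = positive-raised u m

  increment-decrement : ∀ c a → a (proj₁ c) (proj₂ c) ≢ 0 → ∀ i j → a i j ≡ increment c (decrement c a) i j
  increment-decrement c a ac≢0 i j with c ≟ᶜ (i , j)
  ... | yes refl = sym (m+[n∸m]≡n (subst (_≤ a i j) (sym (elementary-self c)) (n≢0⇒n>0 ac≢0)))
  ... | no  c≢ij rewrite elementary-other c i j c≢ij = refl

  -- The entry at the head cell is decremented until it is 0, and then the remaining cells take
  -- over. This entry is the explicit argument `x` of `go`, on which the recursion descends.
  enumerate-complete : ∀ {cs} → All Within cs → ∀ a → Supported cs a → a ∈ₙ enumerate cs (weight n a)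
  enumerate-complete {[]} [] a supp = subst (λ w → a ∈ₙ unit zeroMatrix w)
    (sym (trans (∑∑-cong n (λ i j → cong (_* suc (i + j)) (supp i j λ ()))) (∑∑-zeroMatrix (λ i j → suc (i + j)))))
    (here (λ i j _ _ → supp i j λ ()))
  enumerate-complete {c@(k , l) ∷ cs} (c<n ∷ cs<n) a₀ supp₀ = go (a₀ k l) a₀ supp₀ refl
    where
    go : ∀ x a → Supported (c ∷ cs) a → a k l ≡ x → a ∈ₙ enumerate (c ∷ cs) (weight n a)
    go zero a supp ac≡0 = Anyₚ.++⁺ˡ (enumerate-complete cs<n a supp′)
      where
      supp′ : Supported cs a
      supp′ i j ij∉cs with c ≟ᶜ (i , j)
      ... | yes refl = ac≡0
      ... | no  c≢ij = supp i j λ { (here refl) → c≢ij refl ; (there ij∈cs) → ij∉cs ij∈cs }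
    go (suc x) a supp ac≡1+x = subst (λ w → a ∈ₙ enumerate (c ∷ cs) w) (sym weight-a)
      (Anyₚ.++⁺ʳ (enumerate cs (suc (level c + weight n a′)))
        -- The countdown in `raised` consumes exactly the `level c + 1` by which the increment
        -- raises the weight.
        (subst (a ∈ₙ_) (sym (raised-large (increment c) (level c) (enumerate cs) (level c) (weight n a′)))
          (SetoidMembershipₚ.∈-resp-≈ squareSetoid (λ i j _ _ → sym (a≡ i j))
            (SetoidMembershipₚ.∈-map⁺ squareSetoid squareSetoid {f = increment c}
              (λ p i j i<n j<n → cong (elementary c i j +_) (p i j i<n j<n))
              (go x a′ (λ i j ij∉ → trans (cong (_∸ elementary c i j) (supp i j ij∉)) (0∸n≡0 (elementary c i j)))
                  (cong₂ _∸_ ac≡1+x (elementary-self c)))))))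
      where
      a′ = decrement c a
      a≡ = increment-decrement c a (λ ac≡0 → contradiction (trans (sym ac≡0) ac≡1+x) λ ())
      weight-a : weight n a ≡ suc (level c + weight n a′)
      weight-a = trans (∑∑-cong n (λ i j → cong (_* suc (i + j)) (a≡ i j))) (weight-increment c c<n a′)

antidiagonal triangle : ℕ → List Cell
antidiagonal n = applyUpTo (λ i → i , n ∸ i) (suc n)
triangle zero    = []
triangle (suc n) = antidiagonal n ++ triangle n

∈-antidiagonal⁻ : ∀ {n c} → c ∈ antidiagonal n → level c ≡ n
∈-antidiagonal⁻ {n} c∈ with ∈-applyUpTo⁻ (λ i → i , n ∸ i) c∈
... | i , i<1+n , refl = m+[n∸m]≡n (s≤s⁻¹ i<1+n)

∈-triangle⁻ : ∀ n {c} → c ∈ triangle n → level c < n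
∈-triangle⁻ (suc n) c∈ with ∈-++⁻ (antidiagonal n) c∈
... | inj₁ c∈antidiagonal = ≤-reflexive (cong suc (∈-antidiagonal⁻ c∈antidiagonal))
... | inj₂ c∈triangle     = m<n⇒m<1+n (∈-triangle⁻ n c∈triangle)

∈-triangle⁺ : ∀ {n i j} → i + j < n → (i , j) ∈ triangle n
∈-triangle⁺ {suc n} {i} {j} i+j<1+n with i + j ≟ n
... | yes refl  = ∈-++⁺ˡ (subst (λ x → (i , x) ∈ antidiagonal (i + j)) (m+n∸m≡n i j)
                    (∈-applyUpTo⁺ (λ i′ → i′ , i + j ∸ i′) (s≤s (m≤m+n i j))))
... | no  i+j≢n = ∈-++⁺ʳ (antidiagonal n) (∈-triangle⁺ (≤∧≢⇒< (s≤s⁻¹ i+j<1+n) i+j≢n))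

triangle-within : ∀ n → All (Within n) (triangle n)
triangle-within n = All.tabulate λ {c} c∈ →
  ≤-<-trans (m≤m+n (proj₁ c) (proj₂ c)) (∈-triangle⁻ n c∈) , ≤-<-trans (m≤n+m (proj₂ c) (proj₁ c)) (∈-triangle⁻ n c∈)

triangle-unique : ∀ n → Unique (triangle n)
triangle-unique zero    = []
triangle-unique (suc n) = Uniqueₚ.++⁺
  (Uniqueₚ.applyUpTo⁺₁ (λ i → i , n ∸ i) (suc n) (λ i<j _ i≡j → <⇒≢ i<j (cong proj₁ i≡j)))
  (triangle-unique n)
  (λ (c∈antidiagonal , c∈triangle) → <⇒≢ (∈-triangle⁻ n c∈triangle) (∈-antidiagonal⁻ c∈antidiagonal))

level-triangle : ∀ n → map level (triangle n) ≡ triangleWeights n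
level-triangle zero    = refl
level-triangle (suc n) = trans (map-++ level (antidiagonal n) (triangle n)) (cong₂ _++_
  (trans (map-applyUpTo (λ i → i , n ∸ i) level (suc n)) (constantly (suc n) (λ i i<1+n → m+[n∸m]≡n (s≤s⁻¹ i<1+n))))
  (level-triangle n))
  where
  constantly : ∀ m {f : ℕ → ℕ} → (∀ i → i < m → f i ≡ n) → applyUpTo f m ≡ replicate m n
  constantly zero    f≡n = refl
  constantly (suc m) f≡n = cong₂ _∷_ (f≡n 0 z<s) (constantly m (λ i i<m → f≡n (suc i) (s<s i<m)))

-- A nonzero entry at (i, j) alone contributes at least i + j + 1 to the weight, so a matrix of
-- weight n lives on the cells with i + j < n.
weight-bound : ∀ {n N a} → Vanishing N a → weight N a ≡ n → ∀ i j → n ≤ i + j → a i j ≡ 0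
weight-bound {n} {N} {a} a≡0 w i j n≤i+j with inside-or-outside N i j
... | inj₂ out = a≡0 i j out
... | inj₁ (i<N , j<N) with a i j in eq
...   | zero  = refl
...   | suc x = contradiction n≤i+j (<⇒≱ (begin-strict
  i + j                    <⟨ n<1+n (i + j) ⟩
  suc (i + j)              ≤⟨ m≤n*m (suc (i + j)) (suc x) ⟩
  suc x * suc (i + j)      ≡⟨ cong (_* suc (i + j)) eq ⟨
  a i j * suc (i + j)      ≤⟨ term≤∑ (λ j → a i j * suc (i + j)) j<N ⟩
  ∑ N (λ j → a i j * suc (i + j)) ≤⟨ term≤∑ (λ i → ∑ N (λ j → a i j * suc (i + j))) i<N ⟩
  weight N a               ≡⟨ w ⟩
  n                        ∎))
  where open ≤-Reasoning

-- Parametrisations of plane partitions by matrices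

record Parametrisation (size′ weight′ : PlanePartition → ℕ) : Set where
  field
    build        : ℕ → Matrix → PlanePartition
    build-size   : ∀ n a → size′ (build n a) ≡ ∑∑ n a
    build-weight : ∀ n a → weight′ (build n a) ≡ weight n a
    build-cong   : ∀ n {a b} → (∀ i j → i < n → j < n → a i j ≡ b i j) → build n a ≈ᵖ build n b
    injective    : ∀ n {a b} → build n a ≈ᵖ build n b → ∀ i j → restrict a n i j ≡ restrict b n i j
    -- `N` comes from `π`, while coefficient `n` is enumerated on the square of side `n`; the last
    -- clause makes the construction independent of the square containing the support.
    surjective   : ∀ π → ∃[ N ] ∃[ a ] Vanishing N a × (∀ n → Vanishing n a → build n a ≈ᵖ π)
    weight-cong  : ∀ π ρ → π ≈ᵖ ρ → weight′ π ≡ weight′ ρ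

∑∑-restrict : ∀ n a (g : ℕ → ℕ → ℕ) → ∑∑ n (λ i j → restrict a n i j * g i j) ≡ ∑∑ n (λ i j → a i j * g i j)
∑∑-restrict n a g = ∑∑-cong-< n (λ i j i<n j<n → cong (_* g i j) (restrict-inside a n i<n j<n))

∑∑-restrict-1 : ∀ n a → ∑∑ n (restrict a n) ≡ ∑∑ n a
∑∑-restrict-1 n a = ∑∑-cong-< n (λ i j i<n j<n → restrict-inside a n i<n j<n)

trace-volume : Parametrisation trace volume
trace-volume = record
  { build        = λ n a → fromGrowth (G n a)
  ; build-size   = λ n a → trans (trace-fromGrowth (G n a)) (∑∑-restrict-1 n a)
  ; build-weight = λ n a → trans (volume-fromGrowth (G n a)) (∑∑-restrict n a (λ i j → suc (i + j)))
  ; build-cong   = λ n {a} {b} a≈b x y → growth-unique (G n a) (G n b) (restrict-cong {a} {b} a≈b) (x ∸ y) (y ∸ x) (x ⊓ y)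
  -- Equal arrays have equal diagonals, which are the boundary of the growth; the backward reading
  -- recovers the interior and then the matrix.
  ; injective    = λ n {a} {b} p → matrix-unique (G n a) (G n b) (λ i j → boundary-unique (G n a) (G n b)
      (λ i r → trans (sym (assemble-below (matrixGrowth a n) i r)) (trans (p (r + i) r) (assemble-below (matrixGrowth b n) i r)))
      (λ j r → trans (sym (assemble-beside (matrixGrowth a n) j r)) (trans (p r (r + j)) (assemble-beside (matrixGrowth b n) j r)))
      i j 0)
  ; surjective   = λ π → size π , excess π , excess-vanishing π , λ n a≡0 x y →
      trans (growth-unique (G n (excess π)) (diagonalGrowth π) (restrict-vanishing (excess π) n a≡0) (x ∸ y) (y ∸ x) (x ⊓ y))
            (assemble-diagonals π x y)
  ; weight-cong  = volume-cong
  }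
  where
  G : ∀ n a → Growth (restrict a n) (matrixGrowth a n)
  G n a = matrixGrowth-isGrowth a n

des-upHookVolume : Parametrisation des upHookVolume
des-upHookVolume = record
  { build        = λ n a → conjugate (F n a)
  ; build-size   = λ n a → trans (des-conjugate-firstParts (G n a)) (∑∑-restrict-1 n a)
  ; build-weight = λ n a → trans (upHookVolume-conjugate-firstParts (G n a)) (∑∑-restrict n a (λ i j → suc (i + j)))
  ; build-cong   = λ n {a} {b} a≈b → conjugate-cong (F n a) (F n b)
      (λ i l → growth-unique (G n a) (G n b) (restrict-cong {a} {b} a≈b) i l 0)
  -- Conjugating again recovers the first parts, which determine the matrix.
  ; injective    = λ n {a} {b} p → matrix-unique (G n a) (G n b) (λ i l →
      trans (sym (conjugate-involutive (F n a) i l))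
      (trans (conjugate-cong (conjugate (F n a)) (conjugate (F n b)) p i l) (conjugate-involutive (F n b) i l)))
  ; surjective   = λ π → size (conjugate π) , increments (conjugate π) ,
      increments-vanishing (conjugate π) , λ n a≡0 i j →
      trans (conjugate-cong (F n (increments (conjugate π))) (conjugate π)
              (firstParts-increments (conjugate π) (G n (increments (conjugate π)))
                (restrict-vanishing (increments (conjugate π)) n a≡0)) i j)
            (conjugate-involutive π i j)
  ; weight-cong  = upHookVolume-cong
  }
  where
  G : ∀ n a → Growth (restrict a n) (matrixGrowth a n)
  G n a = matrixGrowth-isGrowth a n
  F : ℕ → Matrix → PlanePartition
  F n a = firstParts (G n a)

-- Summation over plane partitions

module _ {c ℓ} (R : CommutativeRing c ℓ) (τ : CommutativeRing.Carrier R) where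
  private module R = CommutativeRing R
  open PowerSeries R.rawRing using (Series; IsSum) renaming (indeterminate to q; _^_ to _^ₛ_)
  open import Algebra.Properties.CommutativeSemiring.Exp R.commutativeSemiring using () renaming (_^_ to _^ᴿ_)
  open GeneratingFunctions R τ

  module _ {size′ weight′} (P : Parametrisation size′ weight′) (term : ℕ → ℕ → Series)
           (term-coefficient : ∀ d v n → term d v n R.≈ (τ ^ᴿ d) R.* (q ^ₛ v) n) where
    open Parametrisation P

    -- Coefficient `n` is witnessed by the images of the weight-n matrices on the triangle i + j <
    -- n. A plane partition of another weight has coefficient 0 there, and one of weight n comes
    -- from such a matrix by `weight-bound`.
    isSum : IsSum planePartitions (λ π → term (size′ π) (weight′ π)) matrixSeries
    isSum n = map (build n) as , unique , complete , R.trans (total as (enumerate-weight n (triangle-within n) n))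
      (R.reflexive (cong {B = R.Carrier} evaluate
        (trans (sizes-enumerate n (triangle-within n) n) (cong (λ vs → sizes vs n) (level-triangle n)))))
      where
      as = enumerate (triangle n) n

      unique = SetoidUniqueₚ.map⁺ (squareSetoid n) planePartitions {f = build n}
        (λ {a} {b} p i j i<n j<n → trans (sym (restrict-inside a n i<n j<n))
          (trans (injective n p i j) (restrict-inside b n i<n j<n)))
        (enumerate-unique n (triangle-within n) (triangle-unique n) n)

      open SetoidMembership planePartitions using () renaming (_∈_ to _∈ᵖ_)

      complete : ∀ π → ¬ term (size′ π) (weight′ π) n R.≈ R.0# → π ∈ᵖ map (build n) as
      complete π nonzero with weight′ π ≟ n
      ... | no  w≢n = contradiction
        (R.trans (term-coefficient (size′ π) (weight′ π) n)
          (R.trans (R.*-congˡ (q^-off-diagonal (weight′ π) n w≢n)) (R.zeroʳ _))) nonzero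
      ... | yes w≡n with surjective π
      ...   | N , a , a-vanishing , build≈π = SetoidMembershipₚ.∈-resp-≈ planePartitions {_} {build n a} {π} (build≈π n vanishingₙ)
        (SetoidMembershipₚ.∈-map⁺ (squareSetoid n) planePartitions (build-cong n)
          (subst (λ w → SetoidMembership._∈_ (squareSetoid n) a (enumerate (triangle n) w)) weightₙ
            (enumerate-complete n (triangle-within n) a supported)))
        where
        weight-a : weight N a ≡ n
        weight-a = trans (sym (build-weight N a)) (trans (weight-cong (build N a) π (build≈π N a-vanishing)) w≡n)
        beyond = weight-bound a-vanishing weight-a
        vanishingₙ : Vanishing n a
        vanishingₙ i j (inj₁ n≤i) = beyond i j (m≤n⇒m≤n+o j n≤i)
        vanishingₙ i j (inj₂ n≤j) = beyond i j (m≤n⇒m≤o+n i n≤j)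
        weightₙ : weight n a ≡ n
        -- The matrix vanishes outside both squares, so its weight may be computed on either.
        weightₙ = trans (∑∑-cong-vanishing (λ i j → refl) (λ i j → cong (_* suc (i + j)) ∘ vanishingₙ i j)
                                             (λ i j → cong (_* suc (i + j)) ∘ a-vanishing i j)) weight-a
        supported : Supported (triangle n) a
        supported i j ij∉ = beyond i j (≮⇒≥ (ij∉ ∘ ∈-triangle⁺))

      total : ∀ xs → All (λ a → weight n a ≡ n) xs →
        foldr R._+_ R.0# (map (λ π → term (size′ π) (weight′ π) n) (map (build n) xs)) R.≈ evaluate (map (∑∑ n) xs)
      total []       []       = R.refl
      total (a ∷ xs) (w ∷ ws) = R.+-cong (begin
        term (size′ (build n a)) (weight′ (build n a)) n ≡⟨ cong₂ (λ d v → term d v n) (build-size n a) (trans (build-weight n a) w) ⟩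
        term (∑∑ n a) n n                ≈⟨ term-coefficient (∑∑ n a) n n ⟩
        (τ ^ᴿ ∑∑ n a) R.* (q ^ₛ n) n     ≈⟨ R.*-congˡ (q^-diagonal n) ⟩
        (τ ^ᴿ ∑∑ n a) R.* R.1#           ≈⟨ R.*-identityʳ _ ⟩
        τ ^ᴿ ∑∑ n a                      ∎) (total xs ws)
        where open import Relation.Binary.Reasoning.Setoid R.setoid

corollary6p4 : (let open Uni in
    ∃[ F ]
    IsSum planePartitions (λ π → q ^ upHookVolume π) F
    × IsInfiniteProduct factor F
    × IsSum planePartitions (λ π → q ^ volume π) F)
    ×
    (let open Bi in
    ∃[ F ]
    IsSum planePartitions (λ π → (t ^ des π) ⊛ (q ^ upHookVolume π)) F
    × IsInfiniteProduct factor F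
    × IsSum planePartitions (λ π → (t ^ trace π) ⊛ (q ^ volume π)) F)
corollary6p4 = univariate , bivariate
  where
  ℤᴿ = ℤ.+-*-commutativeRing
  open SeriesRing ℤᴿ using (constant-⊛) renaming (powerSeriesRing to ℤ[[t]]ᴿ)

  univariate : let open Uni in ∃[ F ]
      IsSum planePartitions (λ π → q ^ upHookVolume π) F
    × IsInfiniteProduct factor F
    × IsSum planePartitions (λ π → q ^ volume π) F
  univariate = matrixSeries
    , isSum ℤᴿ ℤ.1ℤ des-upHookVolume (λ _ v → q ^ v) coefficient
    -- At τ = 1 the denominator contains the constant series 1 times q^k, which is simplified to the
    -- q^k of the factor.
    , isInfiniteProduct factor (λ i → reciprocal-denominator i (λ n →
        cong (λ x → 1# n ℤ.- x) (sym (trans (constant-⊛ (constant ℤ.1ℤ) (q ^ suc i) n (λ _ → refl)) (ℤ.*-identityˡ _)))))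
    , isSum ℤᴿ ℤ.1ℤ trace-volume (λ _ v → q ^ v) coefficient
    where
    open Uni
    open GeneratingFunctions ℤᴿ ℤ.1ℤ
    open Exp (CommutativeRing.commutativeSemiring ℤᴿ) using () renaming (_^_ to _^ᶻ_)
    1^d≡1 : ∀ d → ℤ.1ℤ ^ᶻ d ≡ ℤ.1ℤ
    1^d≡1 zero    = refl
    1^d≡1 (suc d) = trans (ℤ.*-identityˡ _) (1^d≡1 d)
    coefficient : ∀ d v n → (q ^ v) n ≡ (ℤ.1ℤ ^ᶻ d) ℤ.* (q ^ v) n
    coefficient d v n = sym (trans (cong (ℤ._* (q ^ v) n) (1^d≡1 d)) (ℤ.*-identityˡ _))

  bivariate : let open Bi in ∃[ F ]
      IsSum planePartitions (λ π → (t ^ des π) ⊛ (q ^ upHookVolume π)) F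
    × IsInfiniteProduct factor F
    × IsSum planePartitions (λ π → (t ^ trace π) ⊛ (q ^ volume π)) F
  bivariate = matrixSeries
    , isSum ℤ[[t]]ᴿ τ des-upHookVolume (λ d v → (t ^ d) ⊛ (q ^ v)) coefficient
    , isInfiniteProduct factor factor-inverse
    , isSum ℤ[[t]]ᴿ τ trace-volume (λ d v → (t ^ d) ⊛ (q ^ v)) coefficient
    where
    open Bi
    τ = PowerSeries.indeterminate ℤ.+-*-rawRing
    open GeneratingFunctions ℤ[[t]]ᴿ τ
    module T = CommutativeRing ℤ[[t]]ᴿ
    open Exp T.commutativeSemiring using () renaming (_^_ to _^ᵀ_)
    coefficient : ∀ d v n → ((t ^ d) ⊛ (q ^ v)) n T.≈ (τ ^ᵀ d) T.* (q ^ v) n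
    coefficient d v = constant-^-⊛ d (q ^ v)
    factor-inverse : ∀ i → factor i ⊛ (denominator i ^ suc i) ≋ 1#
    factor-inverse i = reciprocal-denominator i {1# ⊕ (- (t ⊛ (q ^ suc i)))} (λ _ _ → refl)
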